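{- Let $\ell\ge1$ be an integer, let $\mathscr{R}=\{(a,b)\in\mathbb{Z}^2: 0\le a\le b\le \ell-1\}$ with the componentwise order, and let $\mathrm{wt}$ be a rank increasing and rank constant weight function on $\mathscr{R}$. If $A\subseteq\mathscr{R}$ is an optimal downset, then one of the following holds: (1) $A$ is the initial segment of size $|A|$ of $\mathcal{L}$ or of $\mathcal{C}$ (restricted to $\mathscr{R}$); (2) there exist $\mathcal{D}\in\{\mathcal{L},\mathcal{C}\}$, a packed poset $\mathscr{Q}\subseteq\mathscr{R}$ and coordinates $c_1,c_2\in\{1,2\}$ such that $A=\mathrm{Sym}(\mathscr{Q},I,c_1,c_2)$, where $I$ is the initial segment of size $|A|$ of $\mathcal{D}$ restricted to $\mathscr{R}$.
   Context: The rank of $(a,b)$ is $a+b$; $\mathrm{wt}$ is rank constant if equal ranks give equal weights and rank increasing if strictly smaller rank gives strictly smaller weight; $\mathrm{wt}(S)=\sum_{s\in S}\mathrm{wt}(s)$. A downset of $\mathscr{R}$ is a subset $A$ with: $x\le y$ componentwise, $x\in\mathscr{R}$, $y\in A$ imply $x\in A$; it is optimal if its weight is at least that of every downset of $\mathscr{R}$ of the same size. $\mathcal{L}$: $(a,b)<(c,d)$ iff $a<c$, or $a=c$ and $b<d$. $\mathcal{C}$: $(a,b)<(c,d)$ iff $b<d$, or $b=d$ and $a<c$. The initial segment of size $m$ is the set of the $m$ smallest elements of $\mathscr{R}$ in the order. A packed poset in $\mathscr{R}$ is a set $\mathscr{Q}=\{(a,b): s_1\le a\le t_1,\ s_2\le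 b\le t_2\}$ contained in $\mathscr{R}$. For $c_1=c_2$, $\mathrm{Sym}(\mathscr{Q},A,c_1,c_2)=A$; for $\{c_1,c_2\}=\{1,2\}$ with $t_1-s_1=t_2-s_2$, let $\rho(a,b)=(s_1+b-s_2,s_2+a-s_1)$ on $\mathscr{Q}$, local coordinates $u_1=a-s_1$, $u_2=b-s_2$ of $f=(a,b)$, $f_{(c_1,c_2)}=\rho(f)$ if $u_{c_1}<u_{c_2}$ and $=f$ otherwise, and $\mathrm{Sym}(\mathscr{Q},A,c_1,c_2)=(A\setminus\mathscr{Q})\cup\{f\in A\cap\mathscr{Q}:\rho(f)\in A\}\cup\{f_{(c_1,c_2)}:f\in A\cap\mathscr{Q}\}$.
   Formalization: The weight function wt is taken with rational values instead of real values; everything else is as stated. -}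

module Defs where

open import Data.Nat using (ℕ; zero; suc; _+_; _∸_; _≤_; _<_; _<ᵇ_; _≡ᵇ_; _≤ᵇ_)
open import Data.Bool using (Bool; true; false; if_then_else_; _∧_; _∨_; not)
open import Data.Product using (Σ; _×_; _,_; proj₁; proj₂)
open import Data.Sum using (_⊎_)
open import Data.List using (List; []; _∷_; map; concatMap; upTo; foldr)
open import Data.Fin using (Fin; zero; suc)
open import Data.Rational using (ℚ; 0ℚ) renaming (_+_ to _+ℚ_; _≤_ to _≤ℚ_; _<_ to _<ℚ_)
open import Relation.Binary.PropositionalEquality using (_≡_)
open import Relation.Nullary using (¬_)

-- points of ℤ² with nonnegative coordinates (all points of ℛ are such)
Pt : Set
Pt = ℕ × ℕ

rank : Pt → ℕ
rank (a , b) = a + b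

inR : ℕ → Pt → Set
inR ℓ (a , b) = a ≤ b × b < ℓ

inRᵇ : ℕ → Pt → Bool
inRᵇ ℓ (a , b) = (a ≤ᵇ b) ∧ (b <ᵇ ℓ)

Rlist : ℕ → List Pt
Rlist ℓ = concatMap (λ b → map (λ a → (a , b)) (upTo (suc b))) (upTo ℓ)

RankConstant : ℕ → (Pt → ℚ) → Set
RankConstant ℓ wt = ∀ x y → inR ℓ x → inR ℓ y → rank x ≡ rank y → wt x ≡ wt y

RankIncreasing : ℕ → (Pt → ℚ) → Set
RankIncreasing ℓ wt = ∀ x y → inR ℓ x → inR ℓ y → rank x < rank y → wt x <ℚ wt y

SubsetOfR : ℕ → (Pt → Bool) → Set
SubsetOfR ℓ A = ∀ x → A x ≡ true → inR ℓ x

size : ℕ → (Pt → Bool) → ℕ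
size ℓ A = foldr _+_ 0 (map (λ x → if A x then 1 else 0) (Rlist ℓ))

wtSum : ℕ → (Pt → ℚ) → (Pt → Bool) → ℚ
wtSum ℓ wt A = foldr _+ℚ_ 0ℚ (map (λ x → if A x then wt x else 0ℚ) (Rlist ℓ))

IsDownset : ℕ → (Pt → Bool) → Set
IsDownset ℓ A = SubsetOfR ℓ A ×
  (∀ a b c d → inR ℓ (a , b) → a ≤ c → b ≤ d → A (c , d) ≡ true → A (a , b) ≡ true)

IsOptimal : ℕ → (Pt → ℚ) → (Pt → Bool) → Set
IsOptimal ℓ wt A = IsDownset ℓ A ×
  (∀ B → IsDownset ℓ B → size ℓ B ≡ size ℓ A → wtSum ℓ wt B ≤ℚ wtSum ℓ wt A)

data Order : Set where
  𝓛 𝓒 : Order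

_<[_]_ : Pt → Order → Pt → Bool
(a , b) <[ 𝓛 ] (c , d) = (a <ᵇ c) ∨ ((a ≡ᵇ c) ∧ (b <ᵇ d))
(a , b) <[ 𝓒 ] (c , d) = (b <ᵇ d) ∨ ((b ≡ᵇ d) ∧ (a <ᵇ c))

countBelow : ℕ → Order → Pt → ℕ
countBelow ℓ D x = foldr _+_ 0 (map (λ y → if y <[ D ] x then 1 else 0) (Rlist ℓ))

initSeg : ℕ → Order → ℕ → Pt → Bool
initSeg ℓ D m x = inRᵇ ℓ x ∧ (countBelow ℓ D x <ᵇ m)

record Box : Set where
  constructor box
  field
    s₁ t₁ s₂ t₂ : ℕ

open Box public

inQ : Box → Pt → Set
inQ Q (a , b) = s₁ Q ≤ a × a ≤ t₁ Q × s₂ Q ≤ b × b ≤ t₂ Q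

IsPacked : ℕ → Box → Set
IsPacked ℓ Q = s₁ Q ≤ t₁ Q × s₂ Q ≤ t₂ Q × (∀ x → inQ Q x → inR ℓ x)

ρ : Box → Pt → Pt
ρ Q (a , b) = (s₁ Q + (b ∸ s₂ Q) , s₂ Q + (a ∸ s₁ Q))

u : Box → Fin 2 → Pt → ℕ
u Q zero (a , b) = a ∸ s₁ Q
u Q (suc _) (a , b) = b ∸ s₂ Q

fsym : Box → Fin 2 → Fin 2 → Pt → Pt
fsym Q c₁ c₂ f = if u Q c₁ f <ᵇ u Q c₂ f then ρ Q f else f

-- membership in Sym(Q, A, c₁, c₂) (coordinates 1,2 are Fin 2 indices zero, suc zero)
SymMem : Box → (Pt → Bool) → Fin 2 → Fin 2 → Pt → Set
SymMem Q A zero zero x = A x ≡ true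
SymMem Q A (suc _) (suc _) x = A x ≡ true
SymMem Q A c₁ c₂ x =
  (A x ≡ true × ¬ inQ Q x)
  ⊎ (inQ Q x × A x ≡ true × A (ρ Q x) ≡ true)
  ⊎ Σ Pt (λ f → inQ Q f × A f ≡ true × x ≡ fsym Q c₁ c₂ f)

-- Sym is only defined for c₁ = c₂, or c₁ ≠ c₂ with a square Q
SymDefined : Box → Fin 2 → Fin 2 → Set
SymDefined Q c₁ c₂ = ¬ (c₁ ≡ c₂) → t₁ Q ∸ s₁ Q ≡ t₂ Q ∸ s₂ Q

{-# OPTIONS --safe #-}
-- A downset A of ℛ is encoded by a word of length ℓ in 1 and 0: if (0, ℓ−1) ∈ A then
-- column 0 is full, the first letter is 1 and the rest encodes the shifted downset
-- of the remaining columns; otherwise row ℓ−1 is empty, the first letter is 0 and the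
-- rest encodes A in the smaller triangle.  Reflecting and complementing A complements
-- the word and exchanges 𝓛 and 𝓒.  By induction on ℓ, an optimal word is 1^p 0^x 1 0^y,
-- 1^p 0^n, 1^p 0 1^d 0^y with d ≤ y + 2, or 1^p 0^x 1 1 (initial segments of 𝓛, then their
-- symmetrizations), or the complement of such a word.  The induction step puts 0 in front of one
-- of these words; if the result is not again in the list, a block of consecutive ranks
-- (part of a row or of a column) can be exchanged for a block of larger ranks,
-- contradicting optimality.
module Submission where

open import Defs
open import Algebra.Bundles using (AbelianGroup)
open import Algebra.Structures using (IsAbelianGroup)
open import Data.Bool using (Bool; true; false; if_then_else_; not; _∧_; _∨_)
open import Data.Bool.Properties using (T-≡; T-∧; T-∨; not-involutive)
open import Data.Empty using (⊥-elim)
open import Data.Fin using (Fin; zero; suc)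
open import Data.List using (List; []; _∷_; _++_; length; map; foldr; concat; upTo; applyUpTo)
open import Data.List.Membership.Propositional using (_∈_)
open import Data.List.Membership.Propositional.Properties using (∈-concat⁺′; ∈-concat⁻′; ∈-map⁺; ∈-map⁻; ∈-upTo⁺; ∈-upTo⁻)
open import Data.List.Properties using (length-map; map-++; map-∘; map-cong; map-applyUpTo; concat-++; ++-identityʳ; upTo-∷ʳ)
open import Data.List.Relation.Unary.Any using (here; there)
open import Data.Nat using (ℕ; zero; suc; _+_; _∸_; _≤_; _<_; z≤n; s≤s; _<ᵇ_; _≡ᵇ_; _≤ᵇ_; ⌊_/2⌋; ⌈_/2⌉)
open import Data.Nat.Properties
open import Data.Nat.Tactic.RingSolver using (solve-∀)
open import Data.Product using (Σ; _×_; _,_; proj₁; proj₂)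
open import Data.Rational using (ℚ; 0ℚ; 1ℚ) renaming (_+_ to _+ℚ_; _≤_ to _≤ℚ_; _<_ to _<ℚ_; -_ to -ℚ_)
import Data.Rational.Properties as ℚ
open import Data.Sum using (_⊎_; inj₁; inj₂; swap)
open import Function using (_∘_; case_of_)
open import Function.Bundles using (_⇔_; mk⇔; Equivalence)
open import Level using (0ℓ)
open import Relation.Binary using (tri<; tri≈; tri>)
open import Relation.Binary.PropositionalEquality
open import Relation.Nullary using (¬_; Dec; yes; no)
open import Relation.Nullary.Decidable using (_×-dec_)

open Equivalence using (to; from)
open ≡-Reasoning

-- Two downsets with equally many cells of each rank weigh the same under every rank constant
-- weight, so optimality cannot separate them: hence symmetrizations appear beside initial segments.
-- Pieces of rows and of columns are both runs of consecutive ranks. Knowing only that weight grows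
-- with rank, one can compare two runs of equal length term by term, so each improvement is arranged
-- to move a single run upwards and keep all other ranks. Such an arrangement is an identity in the
-- weight function; at the constant weight 1 it also shows that sizes agree. A leading 1 raises the
-- ranks of the rest by 2, so weights carry the rank `c` of the corner, and improvements are built
-- for all `c`. The obstacle is that the list is only half closed under each letter: 1 in front
-- preserves the forms of 𝓛, 0 in front those of 𝓒. All work lies in 0 before a form of 𝓛; 1 before
-- a form of 𝓒 is its mirror image. In d ≤ y + 2, equality is the case where a whole column turns
-- into a row. The same bound is exactly the condition that the square used for the symmetrization
-- stays inside ℛ.

infixl 6 _⊞_

-- Opaque, so that equations between sums of rationals unify summand by summand.
opaque
  _⊞_ : ℚ → ℚ → ℚ
  _⊞_ = _+ℚ_

  ⊞-isAbelianGroup : IsAbelianGroup _≡_ _⊞_ 0ℚ (-ℚ_)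
  ⊞-isAbelianGroup = ℚ.+-0-isAbelianGroup

  ⊞-mono-< : ∀ {p q r s} → p <ℚ q → r <ℚ s → p ⊞ r <ℚ q ⊞ s
  ⊞-mono-< = ℚ.+-mono-<

  ⊞-monoˡ-< : ∀ r {p q} → p <ℚ q → p ⊞ r <ℚ q ⊞ r
  ⊞-monoˡ-< r = ℚ.+-monoˡ-< r

  ⊞-monoʳ-< : ∀ r {p q} → p <ℚ q → r ⊞ p <ℚ r ⊞ q
  ⊞-monoʳ-< r = ℚ.+-monoʳ-< r

  ⊞-monoˡ-≤ : ∀ r {p q} → p ≤ℚ q → p ⊞ r ≤ℚ q ⊞ r
  ⊞-monoˡ-≤ r = ℚ.+-monoˡ-≤ r

  ⊞-cancelˡ-≤ : ∀ r {p q} → r ⊞ p ≤ℚ r ⊞ q → p ≤ℚ q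
  ⊞-cancelˡ-≤ r {p} {q} r+p≤r+q with q ℚ.<? p
  ... | yes q<p = ⊥-elim (ℚ.<-irrefl refl (ℚ.<-≤-trans (ℚ.+-monoʳ-< r q<p) r+p≤r+q))
  ... | no  q≮p = ℚ.≮⇒≥ q≮p

  neg-distrib-⊞ : ∀ p q → -ℚ (p ⊞ q) ≡ (-ℚ p) ⊞ (-ℚ q)
  neg-distrib-⊞ = ℚ.neg-distrib-+

⊞-abelianGroup : AbelianGroup 0ℓ 0ℓ
⊞-abelianGroup = record { isAbelianGroup = ⊞-isAbelianGroup }

open AbelianGroup ⊞-abelianGroup using () renaming
  (assoc to ⊞-assoc; comm to ⊞-comm; identityˡ to ⊞-identityˡ; identityʳ to ⊞-identityʳ)
open import Algebra.Properties.AbelianGroup ⊞-abelianGroup using () renaming (∙-cancelˡ to ⊞-cancelˡ; ∙-cancelʳ to ⊞-cancelʳ)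
open import Algebra.Solver.CommutativeMonoid (AbelianGroup.commutativeMonoid ⊞-abelianGroup) using (solve; _⊕_; _⊜_; id)

-- Weights of runs of consecutive ranks

seg : (ℕ → ℚ) → ℕ → ℕ → ℚ
seg f c zero    = 0ℚ
seg f c (suc n) = f c ⊞ seg f (suc c) n

seg-cong : ∀ {f g} c d n → (∀ i → i < n → f (c + i) ≡ g (d + i)) → seg f c n ≡ seg g d n
seg-cong c d zero    eq = refl
seg-cong {f} {g} c d (suc n) eq = cong₂ _⊞_
  (subst₂ (λ i j → f i ≡ g j) (+-identityʳ c) (+-identityʳ d) (eq 0 (s≤s z≤n)))
  (seg-cong (suc c) (suc d) n
    (λ i i<n → subst₂ (λ i j → f i ≡ g j) (+-suc c i) (+-suc d i) (eq (suc i) (s≤s i<n))))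

seg-++ : ∀ f c m n → seg f c (m + n) ≡ seg f c m ⊞ seg f (c + m) n
seg-++ f c zero    n = trans (cong (λ i → seg f i n) (sym (+-identityʳ c))) (sym (⊞-identityˡ _))
seg-++ f c (suc m) n = begin
  f c ⊞ seg f (suc c) (m + n)                          ≡⟨ cong (f c ⊞_) (seg-++ f (suc c) m n) ⟩
  f c ⊞ (seg f (suc c) m ⊞ seg f (suc c + m) n)       ≡⟨ ⊞-assoc _ _ _ ⟨
  (f c ⊞ seg f (suc c) m) ⊞ seg f (suc c + m) n       ≡⟨ cong (λ i → (f c ⊞ seg f (suc c) m) ⊞ seg f i n) (sym (+-suc c m)) ⟩
  (f c ⊞ seg f (suc c) m) ⊞ seg f (c + suc m) n       ∎

seg-1 : ∀ f c → seg f c 1 ≡ f c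
seg-1 f c = ⊞-identityʳ _

seg-∷ʳ : ∀ f c n → seg f c (suc n) ≡ seg f c n ⊞ f (c + n)
seg-∷ʳ f c n = begin
  seg f c (suc n)               ≡⟨ cong (seg f c) (+-comm 1 n) ⟩
  seg f c (n + 1)               ≡⟨ seg-++ f c n 1 ⟩
  seg f c n ⊞ seg f (c + n) 1  ≡⟨ cong (seg f c n ⊞_) (seg-1 f (c + n)) ⟩
  seg f c n ⊞ f (c + n)        ∎

seg-neg : ∀ f c n → seg (-ℚ_ ∘ f) c n ≡ -ℚ seg f c n
seg-neg f c zero    = refl
seg-neg f c (suc n) = trans (cong (-ℚ f c ⊞_) (seg-neg f (suc c) n)) (sym (neg-distrib-⊞ _ _))

IncreasingBelow : ℕ → (ℕ → ℚ) → Set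
IncreasingBelow N w = ∀ i j → i < j → j < N → w i <ℚ w j

seg-mono-< : ∀ {N w} → IncreasingBelow N w → ∀ i j n → i < j → j + suc n ≤ N → seg w i (suc n) <ℚ seg w j (suc n)
seg-mono-< {N} inc i j zero    i<j j≤N = ⊞-monoˡ-< 0ℚ (inc i j i<j (subst (_≤ N) (+-comm j 1) j≤N))
seg-mono-< {N} inc i j (suc n) i<j j≤N = ⊞-mono-<
  (inc i j i<j (≤-trans (s≤s (m≤m+n j (suc n))) (subst (_≤ N) (+-suc j (suc n)) j≤N)))
  (seg-mono-< inc (suc i) (suc j) n (s≤s i<j) (subst (_≤ N) (+-suc j (suc n)) j≤N))

-- Words and their weights

Word : Set
Word = List Bool

rep : Bool → ℕ → Word → Word
rep b zero    ε = ε
rep b (suc n) ε = b ∷ rep b n ε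

ones zeros : ℕ → Word → Word
ones  = rep true
zeros = rep false

rep-∷ : ∀ b n ε → rep b n (b ∷ ε) ≡ b ∷ rep b n ε
rep-∷ b zero    ε = refl
rep-∷ b (suc n) ε = cong (b ∷_) (rep-∷ b n ε)

rep-+ : ∀ b m n ε → rep b (m + n) ε ≡ rep b m (rep b n ε)
rep-+ b zero    n ε = refl
rep-+ b (suc m) n ε = cong (b ∷_) (rep-+ b m n ε)

length-rep : ∀ b n ε → length (rep b n ε) ≡ n + length ε
length-rep b zero    ε = refl
length-rep b (suc n) ε = cong suc (length-rep b n ε)

complement : Word → Word
complement = map not

complement-rep : ∀ b n ε → complement (rep b n ε) ≡ rep (not b) n (complement ε)
complement-rep b zero    ε = refl
complement-rep b (suc n) ε = cong (not b ∷_) (complement-rep b n ε)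

-- `c` is the rank of the corner of the triangle. Splitting off a full column 0 moves the corner
-- from (0, 0) to (1, 1), hence `2 + c`; dropping an empty top row leaves it in place.
W : (ℕ → ℚ) → ℕ → Word → ℚ
W w c []          = 0ℚ
W w c (true ∷ ε)  = seg w c (suc (length ε)) ⊞ W w (2 + c) ε
W w c (false ∷ ε) = W w c ε

W-neg : ∀ w c ε → W (-ℚ_ ∘ w) c ε ≡ -ℚ W w c ε
W-neg w c []          = refl
W-neg w c (true ∷ ε)  = trans (cong₂ _⊞_ (seg-neg w c (suc (length ε))) (W-neg w (2 + c) ε)) (sym (neg-distrib-⊞ _ _))
W-neg w c (false ∷ ε) = W-neg w c ε

W-zeros : ∀ w c n ε → W w c (zeros n ε) ≡ W w c ε
W-zeros w c zero    ε = refl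
W-zeros w c (suc n) ε = W-zeros w c n ε

W-zeros1zeros : ∀ w c x y → W w c (zeros x (true ∷ zeros y [])) ≡ seg w c (suc y)
W-zeros1zeros w c x y = begin
  W w c (zeros x (true ∷ zeros y []))                            ≡⟨ W-zeros w c x _ ⟩
  seg w c (suc (length (zeros y []))) ⊞ W w (2 + c) (zeros y []) ≡⟨ cong₂ (λ n v → seg w c (suc n) ⊞ v)
                                                                       (trans (length-rep false y []) (+-identityʳ y))
                                                                       (W-zeros w (2 + c) y []) ⟩
  seg w c (suc y) ⊞ 0ℚ                                          ≡⟨ ⊞-identityʳ _ ⟩
  seg w c (suc y)                                                ∎

-- The full columns see the rest of the word only through its length `n`, so this part cancels when
-- two words share the prefix 1^p and have equal length.
onesWeight : (ℕ → ℚ) → ℕ → ℕ → ℕ → ℚ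
onesWeight w c zero    n = 0ℚ
onesWeight w c (suc p) n = seg w c (suc (p + n)) ⊞ onesWeight w (2 + c) p n

W-ones : ∀ w c p ε → W w c (ones p ε) ≡ onesWeight w c p (length ε) ⊞ W w (c + (p + p)) ε
W-ones w c zero    ε = trans (cong (λ c → W w c ε) (sym (+-identityʳ c))) (sym (⊞-identityˡ _))
W-ones w c (suc p) ε = begin
  seg w c (suc (length (ones p ε))) ⊞ W w (2 + c) (ones p ε)
    ≡⟨ cong₂ (λ n v → seg w c (suc n) ⊞ v) (length-rep true p ε) (W-ones w (2 + c) p ε) ⟩
  seg w c (suc (p + length ε)) ⊞ (onesWeight w (2 + c) p (length ε) ⊞ W w (2 + c + (p + p)) ε)
    ≡⟨ ⊞-assoc _ _ _ ⟨
  onesWeight w c (suc p) (length ε) ⊞ W w (2 + c + (p + p)) ε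
    ≡⟨ cong (λ d → onesWeight w c (suc p) (length ε) ⊞ W w d ε) (eq c p) ⟩
  onesWeight w c (suc p) (length ε) ⊞ W w (c + (suc p + suc p)) ε ∎
  where
  eq : ∀ c p → 2 + c + (p + p) ≡ c + (suc p + suc p)
  eq = solve-∀

-- Moving a 0 to the left across 1ˢ deletes the last s cells of a row.
W-row : ∀ w c s ε → W w c (ones s (false ∷ ε)) ≡ W w c (ones s ε) ⊞ seg w (c + s + length ε) s
W-row w c zero    ε = sym (⊞-identityʳ _)
W-row w c (suc s) ε = begin
  seg w c (suc (length (ones s (false ∷ ε)))) ⊞ W w (2 + c) (ones s (false ∷ ε))
    ≡⟨ cong₂ (λ n v → seg w c (suc n) ⊞ v) (trans (length-rep true s (false ∷ ε)) (+-suc s n)) (W-row w (2 + c) s ε) ⟩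
  seg w c (suc (suc (s + n))) ⊞ (W w (2 + c) (ones s ε) ⊞ seg w (2 + c + s + n) s)
    ≡⟨ cong (_⊞ (W w (2 + c) (ones s ε) ⊞ seg w (2 + c + s + n) s)) (seg-∷ʳ w c (suc (s + n))) ⟩
  (seg w c (suc (s + n)) ⊞ w (c + suc (s + n))) ⊞ (W w (2 + c) (ones s ε) ⊞ seg w (2 + c + s + n) s)
    ≡⟨ solve 4 (λ x y z t → ((x ⊕ y) ⊕ (z ⊕ t)) ⊜ ((x ⊕ z) ⊕ (y ⊕ t))) refl
         (seg w c (suc (s + n))) (w (c + suc (s + n))) (W w (2 + c) (ones s ε)) (seg w (2 + c + s + n) s) ⟩
  (seg w c (suc (s + n)) ⊞ W w (2 + c) (ones s ε)) ⊞ (w (c + suc (s + n)) ⊞ seg w (2 + c + s + n) s)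
    ≡⟨ cong₂ _⊞_ (cong (λ m → seg w c (suc m) ⊞ W w (2 + c) (ones s ε)) (sym (length-rep true s ε)))
         (cong₂ (λ i j → w i ⊞ seg w j s) (eq₁ c s n) (eq₂ c s n)) ⟩
  W w c (ones (suc s) ε) ⊞ seg w (c + suc s + n) (suc s) ∎
  where
  n = length ε
  eq₁ : ∀ c s n → c + suc (s + n) ≡ c + suc s + n
  eq₁ = solve-∀
  eq₂ : ∀ c s n → 2 + c + s + n ≡ suc (c + suc s + n)
  eq₂ = solve-∀

W-row-ones : ∀ w c s ε → W w c (ones s (false ∷ ε)) ≡
  onesWeight w c s (length ε) ⊞ (W w (c + (s + s)) ε ⊞ seg w (c + s + length ε) s)
W-row-ones w c s ε = trans (W-row w c s ε) (trans (cong (_⊞ seg w (c + s + length ε) s) (W-ones w c s ε)) (⊞-assoc _ _ _))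

-- Optimality, exchange certificates and ties

Optimal : (ℕ → ℚ) → ℕ → Word → Set
Optimal w c ε = ∀ ε′ → length ε′ ≡ length ε → W (λ _ → 1ℚ) c ε′ ≡ W (λ _ → 1ℚ) c ε → W w c ε′ ≤ℚ W w c ε

-- A certificate that ε is not optimal: up to the ranks in `common`, another word
-- replaces the ranks γ, …, γ + s by the larger ranks β, …, β + s.
record Gain (c : ℕ) (ε : Word) : Set where
  constructor gain
  field
    better : Word
    len    : length better ≡ length ε
    γ β s  : ℕ
    γ<β    : γ < β
    bound  : suc (β + suc s) ≤ c + (length ε + length ε)
    common : (ℕ → ℚ) → ℚ
    before : ∀ w → W w c ε ≡ common w ⊞ seg w γ (suc s)
    after  : ∀ w → W w c better ≡ common w ⊞ seg w β (suc s)

seg-const : ∀ q c d n → seg (λ _ → q) c n ≡ seg (λ _ → q) d n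
seg-const q c d n = seg-cong c d n (λ _ _ → refl)

-- `before` and `after` hold for every weight: at the constant weight 1 they make the two sizes
-- equal, at `w` they leave a strict comparison of two runs. A triangle of side n with corner rank c
-- has top rank c + 2n - 2, and `bound` keeps the new run within it, where `w` is known to increase.
gain⇒¬optimal : ∀ {w N c ε} → IncreasingBelow N w → c + (length ε + length ε) ≤ suc N → Gain c ε → ¬ Optimal w c ε
gain⇒¬optimal {w} {N} {c} {ε} inc c≤N g opt = ℚ.<-irrefl refl
  (ℚ.<-≤-trans (subst₂ _<ℚ_ (sym (before w)) (sym (after w))
     (⊞-monoʳ-< (common w) (seg-mono-< inc γ β s γ<β (≤-pred (≤-trans bound c≤N)))))
   (opt better len (trans (after _) (trans (cong (common _ ⊞_) (seg-const 1ℚ β γ (suc s))) (sym (before _))))))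
  where open Gain g

-- Both words receive the same full column or the same empty row, which joins the common part. The
-- letter 1 needs the certificate at corner rank `2 + c`, whence the quantification over `c`.
gain-∷ : ∀ b {ε} → (∀ c → Gain c ε) → ∀ c → Gain c (b ∷ ε)
gain-∷ true {ε} h c = gain (true ∷ better) (cong suc len) γ β s γ<β (≤-trans bound (≤-reflexive (eq c (length ε))))
  (λ w → seg w c (suc (length ε)) ⊞ common w)
  (λ w → trans (cong (_ ⊞_) (before w)) (sym (⊞-assoc _ _ _)))
  (λ w → trans (cong₂ (λ n v → seg w c (suc n) ⊞ v) len (after w)) (sym (⊞-assoc _ _ _)))
  where
  open Gain (h (2 + c))
  eq : ∀ c n → 2 + c + (n + n) ≡ c + (suc n + suc n)
  eq = solve-∀
gain-∷ false {ε} h c = gain (false ∷ better) (cong suc len) γ β s γ<β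
  (≤-trans bound (+-monoʳ-≤ c (+-mono-≤ (n≤1+n _) (n≤1+n _)))) common before after
  where open Gain (h c)

gain-rep : ∀ b n {ε} → (∀ c → Gain c ε) → ∀ c → Gain c (rep b n ε)
gain-rep b zero    h = h
gain-rep b (suc n) h = gain-∷ b (gain-rep b n h)

-- Since `w` is arbitrary, the two downsets have equally many cells of each rank. A certificate
-- against one is then a certificate against the other, and their sizes agree.
record Tied (ε ε′ : Word) : Set where
  constructor tied
  field
    len  : length ε ≡ length ε′
    same : ∀ w c → W w c ε ≡ W w c ε′

tied-∷ : ∀ b {ε ε′} → Tied ε ε′ → Tied (b ∷ ε) (b ∷ ε′)
tied-∷ true  (tied len same) = tied (cong suc len) (λ w c → cong₂ (λ n v → seg w c (suc n) ⊞ v) len (same w (2 + c)))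
tied-∷ false (tied len same) = tied (cong suc len) same

tied-rep : ∀ b n {ε ε′} → Tied ε ε′ → Tied (rep b n ε) (rep b n ε′)
tied-rep b zero    t = t
tied-rep b (suc n) t = tied-∷ b (tied-rep b n t)

tied-gain : ∀ {ε ε′} → Tied ε ε′ → (∀ c → Gain c ε′) → ∀ c → Gain c ε
tied-gain (tied len same) h c = gain better (trans len′ (sym len)) γ β s γ<β
  (subst (λ n → suc (β + suc s) ≤ c + (n + n)) (sym len) bound) common
  (λ w → trans (same w c) (before w)) after
  where open Gain (h c) renaming (len to len′)

≤⇒∃ : ∀ {m n} → m ≤ n → Σ ℕ (λ k → m + k ≡ n)
≤⇒∃ {m} {n} m≤n = n ∸ m , m+[n∸m]≡n m≤n

length-0* : ∀ y → length (zeros y []) ≡ y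
length-0* y = trans (length-rep false y []) (+-identityʳ y)

length-0*10* : ∀ x y → length (zeros x (true ∷ zeros y [])) ≡ x + suc y
length-0*10* x y = trans (length-rep false x _) (cong (λ n → x + suc n) (length-0* y))

-- The exchanges

-- Turning 0 1^m into 1^m 0 puts `m` new cells on top of the `m` full columns; `η` must have `m`
-- cells fewer than `ε`. The contribution of 1^m below the new row cancels, so only the ranks of the
-- row and of the two tails remain to be compared.
gain-insert-row : ∀ c m ε η γ β s (common : (ℕ → ℚ) → ℚ) → length η ≡ length ε → γ < β →
  suc (β + suc s) ≤ c + ((suc m + length ε) + (suc m + length ε)) →
  (∀ w → W w (c + (m + m)) ε ≡ common w ⊞ seg w γ (suc s)) →
  (∀ w → W w (c + (m + m)) η ⊞ seg w (c + m + length η) m ≡ common w ⊞ seg w β (suc s)) →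
  Gain c (false ∷ ones m ε)
gain-insert-row c m ε η γ β s common len γ<β bound before after = gain
  (ones m (false ∷ η))
  (trans (length-rep true m _) (trans (+-suc m _) (cong suc (trans (cong (m +_) len) (sym (length-rep true m ε))))))
  γ β s γ<β
  (subst (λ n → suc (β + suc s) ≤ c + (suc n + suc n)) (sym (length-rep true m ε)) bound)
  (λ w → onesWeight w c m (length ε) ⊞ common w)
  (λ w → trans (W-ones w c m ε) (trans (cong (onesWeight w c m (length ε) ⊞_) (before w)) (sym (⊞-assoc _ _ _))))
  (λ w → trans (W-row-ones w c m η) (trans (cong₂ (λ n v → onesWeight w c m n ⊞ v) len (after w)) (sym (⊞-assoc _ _ _))))

gain-delete-row : ∀ c m ε η γ β s (common : (ℕ → ℚ) → ℚ) → length η ≡ length ε → γ < β →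
  suc (β + suc s) ≤ c + ((suc m + length ε) + (suc m + length ε)) →
  (∀ w → W w (c + (m + m)) ε ⊞ seg w (c + m + length ε) m ≡ common w ⊞ seg w γ (suc s)) →
  (∀ w → W w (c + (m + m)) η ≡ common w ⊞ seg w β (suc s)) →
  Gain c (ones m (false ∷ ε))
gain-delete-row c m ε η γ β s common len γ<β bound before after = gain
  (false ∷ ones m η)
  (trans (cong suc (trans (length-rep true m η) (cong (m +_) len))) (sym |ε|))
  γ β s γ<β
  (subst (λ n → suc (β + suc s) ≤ c + (n + n)) (sym |ε|) bound)
  (λ w → onesWeight w c m (length ε) ⊞ common w)
  (λ w → trans (W-row-ones w c m ε) (trans (cong (onesWeight w c m (length ε) ⊞_) (before w)) (sym (⊞-assoc _ _ _))))
  (λ w → trans (W-ones w c m η) (trans (cong₂ (λ n v → onesWeight w c m n ⊞ v) len (after w)) (sym (⊞-assoc _ _ _))))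
  where
  |ε| : length (ones m (false ∷ ε)) ≡ suc m + length ε
  |ε| = trans (length-rep true m _) (+-suc m _)

-- The partial column is taller than the number of full columns, so its top cells suffice for a new
-- row over all of these. The row starts `x + 1` ranks above the piece taken away.
gain-column-to-row : ∀ p x y c → Gain c (false ∷ ones (suc p) (zeros (suc x) (true ∷ zeros (suc p + y) [])))
gain-column-to-row p′ x y c = gain-insert-row c p ε η
  (c + (p + p) + suc y) (c + p + length η) p′
  (λ w → seg w (c + (p + p)) (suc y)) (sym |ε|≡|η|)
  (subst (λ n → c + (p + p) + suc y < c + p + n) (sym |η|) (≤-trans (m≤m+n _ x) (≤-reflexive (eq₁ c p x y))))
  (subst₂ (λ m n → suc (c + p + m + p) ≤ c + ((suc p + n) + (suc p + n))) (sym |η|) (sym |ε|)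
     (≤-trans (m≤m+n _ (suc (suc x) + (suc y + p))) (≤-reflexive (eq₂ c p x y))))
  (λ w → begin
    W w (c + (p + p)) ε
      ≡⟨ W-zeros1zeros w (c + (p + p)) (suc x) (p + y) ⟩
    seg w (c + (p + p)) (suc (p + y))
      ≡⟨ cong (seg w (c + (p + p))) (cong suc (+-comm p y)) ⟩
    seg w (c + (p + p)) (suc y + p)
      ≡⟨ seg-++ w (c + (p + p)) (suc y) p ⟩
    seg w (c + (p + p)) (suc y) ⊞ seg w (c + (p + p) + suc y) p ∎)
  (λ w → cong (_⊞ seg w (c + p + length η) p) (W-zeros1zeros w (c + (p + p)) (suc x + p) y))
  where
  p = suc p′
  ε = zeros (suc x) (true ∷ zeros (p + y) [])
  η = zeros (suc x + p) (true ∷ zeros y [])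
  |ε| : length ε ≡ suc x + suc (p + y)
  |ε| = length-0*10* (suc x) (p + y)
  |η| : length η ≡ suc x + p + suc y
  |η| = length-0*10* (suc x + p) y
  eq : ∀ x p y → suc x + suc (p + y) ≡ suc x + p + suc y
  eq = solve-∀
  |ε|≡|η| : length ε ≡ length η
  |ε|≡|η| = trans |ε| (trans (eq x p y) (sym |η|))
  eq₁ : ∀ c p x y → suc (c + (p + p) + suc y) + x ≡ c + p + (suc x + p + suc y)
  eq₁ = solve-∀
  eq₂ : ∀ c p x y → suc (c + p + (suc x + p + suc y) + p) + (suc (suc x) + (suc y + p)) ≡
    c + ((suc p + (suc x + suc (p + y))) + (suc p + (suc x + suc (p + y))))
  eq₂ = solve-∀

-- The partial column is too short to cover all full columns, so the whole of it becomes a row over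
-- the first `y + 1` of them. Its excess `p` is smaller than the number of zeros, which makes the
-- row start `x + 1` ranks above the foot of the column.
gain-short-column-to-row : ∀ y p x c →
  Gain c (false ∷ ones (suc y + p) (zeros (suc (p + x)) (true ∷ zeros y [])))
gain-short-column-to-row y p x c = subst (Gain c ∘ (false ∷_)) (sym (rep-+ true s p _))
  (gain-insert-row c s ε η (d + (p + p)) (c + s + length η) y
    (λ w → onesWeight w d p q) (trans |η| (sym |ε|))
    (subst (λ n → d + (p + p) < c + s + n) (sym |η|) (≤-trans (m≤m+n _ x) (≤-reflexive (eq₁ c y p x))))
    (subst₂ (λ m n → suc (c + s + m + s) ≤ c + ((suc s + n) + (suc s + n))) (sym |η|) (sym |ε|)
      (≤-trans (m≤m+n _ (suc (p + q))) (≤-reflexive (eq₂ c s (p + q)))))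
    (λ w → begin
      W w d ε
        ≡⟨ W-ones w d p _ ⟩
      onesWeight w d p (length (zeros (suc (p + x)) (true ∷ zeros y []))) ⊞ W w (d + (p + p)) (zeros (suc (p + x)) (true ∷ zeros y []))
        ≡⟨ cong₂ (λ n v → onesWeight w d p n ⊞ v) (length-0*10* (suc (p + x)) y) (W-zeros1zeros w (d + (p + p)) (suc (p + x)) y) ⟩
      onesWeight w d p q ⊞ seg w (d + (p + p)) s ∎)
    (λ w → cong (_⊞ seg w (c + s + length η) s) (begin
      W w d η
        ≡⟨ W-ones w d p _ ⟩
      onesWeight w d p (length (zeros q [])) ⊞ W w (d + (p + p)) (zeros q [])
        ≡⟨ cong₂ (λ n v → onesWeight w d p n ⊞ v) (length-0* q) (W-zeros w (d + (p + p)) q []) ⟩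
      onesWeight w d p q ⊞ 0ℚ
        ≡⟨ ⊞-identityʳ _ ⟩
      onesWeight w d p q ∎)))
  where
  s = suc y
  d = c + (s + s)
  q = suc (p + x) + suc y
  ε = ones p (zeros (suc (p + x)) (true ∷ zeros y []))
  η = ones p (zeros q [])
  |ε| : length ε ≡ p + q
  |ε| = trans (length-rep true p _) (cong (p +_) (length-0*10* (suc (p + x)) y))
  |η| : length η ≡ p + q
  |η| = trans (length-rep true p _) (cong (p +_) (length-0* q))
  eq₁ : ∀ c y p x → suc (c + (suc y + suc y) + (p + p)) + x ≡ c + suc y + (p + (suc (p + x) + suc y))
  eq₁ = solve-∀
  eq₂ : ∀ c s n → suc (c + s + n + s) + suc n ≡ c + ((suc s + n) + (suc s + n))
  eq₂ = solve-∀

-- The top row starts one rank above the foot of the partial column and completes that foot to a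
-- full column. The other `y + 1` cells of the partial column move to the next column, one rank
-- higher.
gain-top-row : ∀ x y c → Gain c (ones (suc (x + y)) (zeros (suc x) (true ∷ zeros (suc y) [])))
gain-top-row x y c = gain-delete-row c m ε η (suc d) (2 + d) y
  (λ w → w d ⊞ seg w (suc d) m)
  (trans (cong suc |η′|) (sym |ε|)) ≤-refl
  (subst (λ n → suc (2 + d + suc y) ≤ c + ((suc m + n) + (suc m + n))) (sym |ε|)
     (≤-trans (m≤m+n _ (2 + (x + (x + y)))) (≤-reflexive (eq₁ c x y))))
  (λ w → begin
    W w d ε ⊞ seg w (c + m + length ε) m
      ≡⟨ cong₂ (λ v i → v ⊞ seg w i m) (W-zeros1zeros w d x (suc y)) (trans (cong (c + m +_) |ε|) (eq₂ c x y)) ⟩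
    w d ⊞ seg w (suc d) (suc y) ⊞ seg w (suc d) m
      ≡⟨ solve 3 (λ a b e → ((a ⊕ b) ⊕ e) ⊜ ((a ⊕ e) ⊕ b)) refl (w d) (seg w (suc d) (suc y)) (seg w (suc d) m) ⟩
    w d ⊞ seg w (suc d) m ⊞ seg w (suc d) (suc y) ∎)
  (λ w → cong₂ (λ n v → w d ⊞ seg w (suc d) n ⊞ v) (trans |η′| (+-suc x y)) (W-zeros1zeros w (2 + d) x y))
  where
  m = suc (x + y)
  d = c + (m + m)
  ε = zeros x (true ∷ zeros (suc y) [])
  η′ = zeros x (true ∷ zeros y [])
  η = true ∷ η′
  |η′| : length η′ ≡ x + suc y
  |η′| = length-0*10* x y
  |ε| : length ε ≡ suc (x + suc y)
  |ε| = trans (length-0*10* x (suc y)) (+-suc x (suc y))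
  eq₁ : ∀ c x y → suc (2 + (c + (suc (x + y) + suc (x + y))) + suc y) + (2 + (x + (x + y))) ≡
    c + ((suc (suc (x + y)) + suc (x + suc y)) + (suc (suc (x + y)) + suc (x + suc y)))
  eq₁ = solve-∀
  eq₂ : ∀ c x y → c + suc (x + y) + suc (x + suc y) ≡ suc (c + (suc (x + y) + suc (x + y)))
  eq₂ = solve-∀

-- The partial column is a single cell, and the top row starts at its rank. The row turns into a
-- full column of the same ranks, and the displaced cell goes to the foot of the following column,
-- two ranks up.
gain-top-row-1 : ∀ r c → Gain c (ones (2 + r) (zeros (2 + r) (true ∷ [])))
gain-top-row-1 r c = gain-delete-row c m ε η d (2 + d) 0
  (λ w → seg w d m)
  (trans (cong suc |η′|) (sym |ε|)) (n≤1+n _)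
  (subst (λ n → suc (2 + d + 1) ≤ c + ((suc m + n) + (suc m + n))) (sym |ε|)
     (≤-trans (m≤m+n _ (2 + (r + r))) (≤-reflexive (eq₁ c r))))
  (λ w → begin
    W w d ε ⊞ seg w (c + m + length ε) m
      ≡⟨ cong₂ (λ v i → v ⊞ seg w i m) (W-zeros1zeros w d (suc r) 0) (trans (cong (c + m +_) |ε|) (+-assoc c m m)) ⟩
    seg w d 1 ⊞ seg w d m
      ≡⟨ ⊞-comm _ _ ⟩
    seg w d m ⊞ seg w d 1 ∎)
  (λ w → cong₂ (λ n v → seg w d (suc n) ⊞ v) |η′| (W-zeros1zeros w (2 + d) r 0))
  where
  m = 2 + r
  d = c + (m + m)
  ε = zeros (suc r) (true ∷ [])
  η′ = zeros r (true ∷ [])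
  η = true ∷ η′
  |η′| : length η′ ≡ suc r
  |η′| = trans (length-rep false r _) (+-comm r 1)
  |ε| : length ε ≡ m
  |ε| = cong suc |η′|
  eq₁ : ∀ c r → suc (2 + (c + ((2 + r) + (2 + r))) + 1) + (2 + (r + r)) ≡
    c + ((3 + r + (2 + r)) + (3 + r + (2 + r)))
  eq₁ = solve-∀

-- There is no partial column: the top row starts at rank `e`, one below the foot of the first empty
-- column. All but its first cell fill that column; the first cell goes to the foot of the column
-- after it, of rank `3 + e`.
gain-top-row-0 : ∀ r c → Gain c (ones (3 + r) (zeros (3 + r) []))
gain-top-row-0 r c = gain-delete-row c m ε η e (3 + e) 0
  (λ w → seg w (suc e) (2 + r))
  (trans (cong suc |η′|) (sym |ε|)) (≤-trans (n≤1+n _) (n≤1+n _))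
  (subst (λ n → suc (3 + e + 1) ≤ c + ((suc m + n) + (suc m + n))) (sym |ε|)
     (≤-trans (m≤m+n _ (2 + (r + r))) (≤-reflexive (eq₁ c r))))
  (λ w → begin
    W w (c + (m + m)) ε ⊞ seg w (c + m + length ε) m
      ≡⟨ cong₂ (λ v i → v ⊞ seg w i m) (W-zeros w (c + (m + m)) (2 + r) []) (cong (c + m +_) |ε|) ⟩
    0ℚ ⊞ (w e ⊞ seg w (suc e) (2 + r))
      ≡⟨ trans (⊞-identityˡ _) (⊞-comm _ _) ⟩
    seg w (suc e) (2 + r) ⊞ w e
      ≡⟨ cong (seg w (suc e) (2 + r) ⊞_) (sym (seg-1 w e)) ⟩
    seg w (suc e) (2 + r) ⊞ seg w e 1 ∎)
  (λ w → trans (cong (λ i → W w i η) (eq₂ c r))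
           (cong₂ (λ n v → seg w (suc e) (suc n) ⊞ v) |η′| (W-zeros1zeros w (3 + e) r 0)))
  where
  m = 3 + r
  e = c + m + (2 + r)
  ε = zeros (2 + r) []
  η′ = zeros r (true ∷ [])
  η = true ∷ η′
  |η′| : length η′ ≡ suc r
  |η′| = trans (length-rep false r _) (+-comm r 1)
  |ε| : length ε ≡ 2 + r
  |ε| = length-0* (2 + r)
  eq₁ : ∀ c r → suc (3 + (c + (3 + r) + (2 + r)) + 1) + (2 + (r + r)) ≡
    c + ((4 + r + (2 + r)) + (4 + r + (2 + r)))
  eq₁ = solve-∀
  eq₂ : ∀ c r → c + ((3 + r) + (3 + r)) ≡ suc (c + (3 + r) + (2 + r))
  eq₂ = solve-∀

-- The top cell of the first column, of rank `c + 2r + 5`, moves to the foot of the first empty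
-- column, a diagonal cell of rank `c + 2r + 8`.
gain-diagonal : ∀ r c → Gain c (true ∷ false ∷ ones (3 + r) (zeros (suc r) []))
gain-diagonal r c = gain-delete-row c 1 ε η (c + 1 + length ε) (c + (1 + 1) + (d + d)) 0
  (λ w → onesWeight w (c + (1 + 1)) d (suc r))
  (trans |η| (sym |ε|))
  (subst (λ n → c + 1 + n < c + (1 + 1) + (d + d)) (sym |ε|) (≤-trans (m≤m+n _ 2) (≤-reflexive (eq₁ c r))))
  (subst (λ n → suc (c + (1 + 1) + (d + d) + 1) ≤ c + ((2 + n) + (2 + n))) (sym |ε|)
     (≤-trans (m≤m+n _ (2 + (r + r))) (≤-reflexive (eq₂ c r))))
  (λ w → cong (_⊞ seg w (c + 1 + length ε) 1) (begin
    W w (c + (1 + 1)) ε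
      ≡⟨ W-ones w (c + (1 + 1)) d _ ⟩
    onesWeight w (c + (1 + 1)) d (length (zeros (suc r) [])) ⊞ W w (c + (1 + 1) + (d + d)) (zeros (suc r) [])
      ≡⟨ cong₂ (λ n v → onesWeight w (c + (1 + 1)) d n ⊞ v) (length-0* (suc r)) (W-zeros w (c + (1 + 1) + (d + d)) (suc r) []) ⟩
    onesWeight w (c + (1 + 1)) d (suc r) ⊞ 0ℚ
      ≡⟨ ⊞-identityʳ _ ⟩
    onesWeight w (c + (1 + 1)) d (suc r) ∎))
  (λ w → begin
    W w (c + (1 + 1)) η
      ≡⟨ W-ones w (c + (1 + 1)) d _ ⟩
    onesWeight w (c + (1 + 1)) d (length (zeros r (true ∷ []))) ⊞ W w (c + (1 + 1) + (d + d)) (zeros r (true ∷ []))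
      ≡⟨ cong₂ (λ n v → onesWeight w (c + (1 + 1)) d n ⊞ v) (trans (length-rep false r _) (+-comm r 1))
           (W-zeros1zeros w (c + (1 + 1) + (d + d)) r 0) ⟩
    onesWeight w (c + (1 + 1)) d (suc r) ⊞ seg w (c + (1 + 1) + (d + d)) 1 ∎)
  where
  d = 3 + r
  ε = ones d (zeros (suc r) [])
  η = ones d (zeros r (true ∷ []))
  |ε| : length ε ≡ d + suc r
  |ε| = trans (length-rep true d _) (cong (d +_) (length-0* (suc r)))
  |η| : length η ≡ d + suc r
  |η| = trans (length-rep true d _) (cong (d +_) (trans (length-rep false r _) (+-comm r 1)))
  eq₁ : ∀ c r → suc (c + 1 + (3 + r + suc r)) + 2 ≡ c + (1 + 1) + ((3 + r) + (3 + r))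
  eq₁ = solve-∀
  eq₂ : ∀ c r → suc (c + (1 + 1) + ((3 + r) + (3 + r)) + 1) + (2 + (r + r)) ≡
    c + ((2 + (3 + r + suc r)) + (2 + (3 + r + suc r)))
  eq₂ = solve-∀

-- Words with the same ranks

-- Below the top row the first `e` columns agree. The hypothesis trades the last column, which
-- starts at rank `c + 2e`, for the top row over these columns together with the cells of `η`.
tied-row-column : ∀ e η y → length η ≡ suc y →
  (∀ w c → W w (c + (e + e)) η ⊞ seg w (c + e + length η) e ≡ seg w (c + (e + e)) (suc y)) →
  Tied (false ∷ ones (suc e) (zeros y [])) (ones e (false ∷ η))
tied-row-column e η y len h = tied
  (trans (cong (2 +_) (trans (length-rep true e _) (cong (e +_) (length-0* y))))
    (trans (eq e y) (sym (trans (length-rep true e _) (cong (λ n → e + suc n) len)))))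
  (λ w c → begin
    W w c (ones (suc e) (zeros y []))
      ≡⟨ cong (W w c) (sym (rep-∷ true e (zeros y []))) ⟩
    W w c (ones e (true ∷ zeros y []))
      ≡⟨ W-ones w c e _ ⟩
    onesWeight w c e (suc (length (zeros y []))) ⊞ W w (c + (e + e)) (true ∷ zeros y [])
      ≡⟨ cong₂ (λ n v → onesWeight w c e n ⊞ v) (trans (cong suc (length-0* y)) (sym len)) (W-zeros1zeros w (c + (e + e)) 0 y) ⟩
    onesWeight w c e (length η) ⊞ seg w (c + (e + e)) (suc y)
      ≡⟨ cong (onesWeight w c e (length η) ⊞_) (h w c) ⟨
    onesWeight w c e (length η) ⊞ (W w (c + (e + e)) η ⊞ seg w (c + e + length η) e)
      ≡⟨ W-row-ones w c e η ⟨
    W w c (ones e (false ∷ η)) ∎)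
  where
  eq : ∀ e y → 2 + (e + y) ≡ e + suc (suc y)
  eq = solve-∀

-- Above its lowest `j + 1` cells the last column has `e` cells, and these start at the very rank
-- where the top row starts: they become that row. The second word is an initial segment of 𝓛.
tied-L₂ : ∀ e j → Tied (false ∷ ones (suc e) (zeros (e + j) [])) (ones e (zeros (suc e) (true ∷ zeros j [])))
tied-L₂ e j = tied-row-column e η (e + j) |η| λ w c → begin
  W w (c + (e + e)) η ⊞ seg w (c + e + length η) e
    ≡⟨ cong₂ (λ v i → v ⊞ seg w i e) (W-zeros1zeros w (c + (e + e)) e j) (trans (cong (c + e +_) |η|) (eq₂ c e j)) ⟩
  seg w (c + (e + e)) (suc j) ⊞ seg w (c + (e + e) + suc j) e
    ≡⟨ seg-++ w (c + (e + e)) (suc j) e ⟨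
  seg w (c + (e + e)) (suc j + e)
    ≡⟨ cong (seg w (c + (e + e))) (cong suc (+-comm j e)) ⟩
  seg w (c + (e + e)) (suc (e + j)) ∎
  where
  η = zeros e (true ∷ zeros j [])
  |η| : length η ≡ suc (e + j)
  |η| = trans (length-0*10* e j) (+-suc e j)
  eq₂ : ∀ c e j → c + e + suc (e + j) ≡ c + (e + e) + suc j
  eq₂ = solve-∀

-- Extreme case: the last column has exactly as many cells as the row over the other columns, and
-- all of it becomes the row.
tied-L₂-0 : ∀ y → Tied (false ∷ ones (2 + y) (zeros y [])) (ones (suc y) (zeros (2 + y) []))
tied-L₂-0 y = tied-row-column e (zeros e []) y |η| λ w c → begin
  W w (c + (e + e)) (zeros e []) ⊞ seg w (c + e + length (zeros e [])) e
    ≡⟨ cong₂ (λ v i → v ⊞ seg w i e) (W-zeros w (c + (e + e)) e []) (trans (cong (c + e +_) |η|) (+-assoc c e e)) ⟩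
  0ℚ ⊞ seg w (c + (e + e)) e
    ≡⟨ ⊞-identityˡ _ ⟩
  seg w (c + (e + e)) e ∎
  where
  e = suc y
  |η| : length (zeros e []) ≡ e
  |η| = length-0* e

-- The triangle of side 2 has one cell of each rank 0, 1, 2, just like a column of three cells.
tied-L₃ : ∀ x → Tied (zeros (suc x) (true ∷ true ∷ [])) (zeros x (true ∷ false ∷ false ∷ []))
tied-L₃ x = subst (λ ε → Tied ε (zeros x (true ∷ false ∷ false ∷ []))) (rep-∷ false x _)
  (tied-rep false x (tied refl λ w c →
    solve 3 (λ a b e → ((a ⊕ (b ⊕ id)) ⊕ ((e ⊕ id) ⊕ id)) ⊜ ((a ⊕ (b ⊕ (e ⊕ id))) ⊕ id)) refl (w c) (w (suc c)) (w (2 + c))))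

-- Reflection and complementation

seg-reflect : ∀ w N d e n → e + n + d ≡ N → seg (λ r → w (N ∸ suc r)) d n ≡ seg w e n
seg-reflect w N d e zero    eq = refl
seg-reflect w N d e (suc n) eq = begin
  w (N ∸ suc d) ⊞ seg (λ r → w (N ∸ suc r)) (suc d) n
    ≡⟨ cong₂ (λ i v → w i ⊞ v) (trans (cong (_∸ suc d) (sym eq′)) (m+n∸n≡m (e + n) (suc d))) (seg-reflect w N (suc d) e n eq′) ⟩
  w (e + n) ⊞ seg w e n
    ≡⟨ ⊞-comm _ _ ⟩
  seg w e n ⊞ w (e + n)
    ≡⟨ seg-∷ʳ w e n ⟨
  seg w e (suc n) ∎
  where
  eq₁ : ∀ e n d → e + n + suc d ≡ e + suc n + d
  eq₁ = solve-∀
  eq′ : e + n + suc d ≡ N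
  eq′ = trans (eq₁ e n d) eq

-- `W` builds the full triangle column by column; the letter 0 of a word accounts for a missing top
-- row, so the complement formula needs the triangle split by that row.
W-ones-last-row : ∀ w c n → W w c (ones (suc n) []) ≡ W w c (ones n []) ⊞ seg w (c + n) (suc n)
W-ones-last-row w c n = begin
  W w c (ones (suc n) [])
    ≡⟨ cong (W w c) (rep-∷ true n []) ⟨
  W w c (ones n (true ∷ []))
    ≡⟨ W-ones w c n _ ⟩
  onesWeight w c n 1 ⊞ (seg w (c + (n + n)) 1 ⊞ 0ℚ)
    ≡⟨ solve 2 (λ a b → (a ⊕ (b ⊕ id)) ⊜ ((a ⊕ id) ⊕ b)) refl (onesWeight w c n 1) (seg w (c + (n + n)) 1) ⟩
  (onesWeight w c n 1 ⊞ 0ℚ) ⊞ seg w (c + (n + n)) 1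
    ≡⟨ cong (_⊞ seg w (c + (n + n)) 1) (trans (sym (W-ones w c n (false ∷ []))) (W-row w c n [])) ⟩
  (W w c (ones n []) ⊞ seg w (c + n + 0) n) ⊞ seg w (c + (n + n)) 1
    ≡⟨ ⊞-assoc _ _ _ ⟩
  W w c (ones n []) ⊞ (seg w (c + n + 0) n ⊞ seg w (c + (n + n)) 1)
    ≡⟨ cong (W w c (ones n []) ⊞_) (cong₂ (λ i j → seg w i n ⊞ seg w j 1) (+-identityʳ (c + n)) (sym (+-assoc c n n))) ⟩
  W w c (ones n []) ⊞ (seg w (c + n) n ⊞ seg w (c + n + n) 1)
    ≡⟨ cong (W w c (ones n []) ⊞_) (seg-++ w (c + n) n 1) ⟨
  W w c (ones n []) ⊞ seg w (c + n) (n + 1)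
    ≡⟨ cong (λ m → W w c (ones n []) ⊞ seg w (c + n) m) (+-comm n 1) ⟩
  W w c (ones n []) ⊞ seg w (c + n) (suc n) ∎

-- The map (a, b) ↦ (n - 1 - b, n - 1 - a) exchanges rows with columns and reverses ranks, taking
-- the cells missing from `ε` to the downset of the complement. The condition on `c + d` makes the
-- ranks of a cell and its image add up to N - 1, so the reversed weight of the image is the weight
-- of the cell.
W-complement : ∀ w N c d ε → c + d + (length ε + length ε) ≡ suc N →
  W w c ε ⊞ W (λ r → w (N ∸ suc r)) d (complement ε) ≡ W w c (ones (length ε) [])
W-complement w N c d []          eq = ⊞-identityˡ 0ℚ
W-complement w N c d (true ∷ ε)  eq = begin
  seg w c (suc n) ⊞ W w (2 + c) ε ⊞ W (λ r → w (N ∸ suc r)) d (complement ε)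
    ≡⟨ ⊞-assoc _ _ _ ⟩
  seg w c (suc n) ⊞ (W w (2 + c) ε ⊞ W (λ r → w (N ∸ suc r)) d (complement ε))
    ≡⟨ cong₂ (λ m v → seg w c (suc m) ⊞ v) (sym (trans (length-rep true n []) (+-identityʳ n)))
         (W-complement w N (2 + c) d ε (trans (eq₁ c d n) eq)) ⟩
  W w c (ones (suc n) []) ∎
  where
  n = length ε
  eq₁ : ∀ c d n → 2 + c + d + (n + n) ≡ c + d + (suc n + suc n)
  eq₁ = solve-∀
W-complement w N c d (false ∷ ε) eq = begin
  W w c ε ⊞ (seg w* d (suc (length (complement ε))) ⊞ W w* (2 + d) (complement ε))
    ≡⟨ solve 3 (λ a b e → (a ⊕ (b ⊕ e)) ⊜ ((a ⊕ e) ⊕ b)) refl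
         (W w c ε) (seg w* d (suc (length (complement ε)))) (W w* (2 + d) (complement ε)) ⟩
  (W w c ε ⊞ W w* (2 + d) (complement ε)) ⊞ seg w* d (suc (length (complement ε)))
    ≡⟨ cong₂ _⊞_ (W-complement w N c (2 + d) ε (trans (eq₁ c d n) eq))
         (trans (cong (λ m → seg w* d (suc m)) (length-map not ε)) (seg-reflect w N d (c + n) (suc n) (suc-injective (trans (eq₂ c d n) eq)))) ⟩
  W w c (ones n []) ⊞ seg w (c + n) (suc n)
    ≡⟨ W-ones-last-row w c n ⟨
  W w c (ones (suc n) []) ∎
  where
  n = length ε
  w* : ℕ → ℚ
  w* r = w (N ∸ suc r)
  eq₁ : ∀ c d n → c + (2 + d) + (n + n) ≡ c + d + (suc n + suc n)
  eq₁ = solve-∀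
  eq₂ : ∀ c d n → suc (c + n + suc n + d) ≡ c + d + (suc n + suc n)
  eq₂ = solve-∀

complement-involutive : ∀ ε → complement (complement ε) ≡ ε
complement-involutive []      = refl
complement-involutive (b ∷ ε) = cong₂ _∷_ (not-involutive b) (complement-involutive ε)

-- Reversal makes the weight decreasing and complementation turns heaviest into lightest; the sign
-- repairs both.
reflect : ℕ → (ℕ → ℚ) → ℕ → ℚ
reflect N w r = -ℚ w (N ∸ suc r)

increasing-reflect : ∀ {N w} → IncreasingBelow N w → IncreasingBelow N (reflect N w)
increasing-reflect inc i j i<j j<N = ℚ.neg-antimono-<
  (inc _ _ (∸-monoʳ-< (s≤s i<j) j<N) (∸-monoʳ-< {o = 0} (s≤s z≤n) (≤-trans i<j (<⇒≤ j<N))))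

-- A competitor of the complement is itself the complement of a competitor of `ε`. Both pairs sum to
-- the full triangle, so the inequality between competitors reverses, and the sign in `reflect`
-- turns it back.
optimal-complement : ∀ {w c} N ε → c + (length ε + length ε) ≡ suc N → Optimal w c ε → Optimal (reflect N w) 0 (complement ε)
optimal-complement {w} {c} N ε eq opt ε′ len size = subst₂ _≤ℚ_
  (sym (W-neg w* 0 ε′)) (sym (W-neg w* 0 (complement ε)))
  (ℚ.neg-antimono-≤ (⊞-cancelˡ-≤ (W w c ε)
    (subst (_≤ℚ W w c ε ⊞ W w* 0 ε′) (trans (dual w) (sym (dual₀ w))) (⊞-monoˡ-≤ (W w* 0 ε′) (opt (complement ε′) len′ size′)))))
  where
  w* : ℕ → ℚ
  w* r = w (N ∸ suc r)
  len′ : length (complement ε′) ≡ length ε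
  len′ = trans (length-map not ε′) (trans len (length-map not ε))
  dual₀ : ∀ v → W v c ε ⊞ W (λ r → v (N ∸ suc r)) 0 (complement ε) ≡ W v c (ones (length ε) [])
  dual₀ v = W-complement v N c 0 ε (trans (cong (_+ _) (+-identityʳ c)) eq)
  dual : ∀ v → W v c (complement ε′) ⊞ W (λ r → v (N ∸ suc r)) 0 ε′ ≡ W v c (ones (length ε) [])
  dual v = begin
    W v c (complement ε′) ⊞ W (λ r → v (N ∸ suc r)) 0 ε′
      ≡⟨ cong (λ η → W v c (complement ε′) ⊞ W (λ r → v (N ∸ suc r)) 0 η) (complement-involutive ε′) ⟨
    W v c (complement ε′) ⊞ W (λ r → v (N ∸ suc r)) 0 (complement (complement ε′))
      ≡⟨ W-complement v N c 0 (complement ε′)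
           (trans (cong₂ (λ a n → a + (n + n)) (+-identityʳ c) len′) eq) ⟩
    W v c (ones (length (complement ε′)) [])
      ≡⟨ cong (λ n → W v c (ones n [])) len′ ⟩
    W v c (ones (length ε) []) ∎
  size′ : W (λ _ → 1ℚ) c (complement ε′) ≡ W (λ _ → 1ℚ) c ε
  size′ = ⊞-cancelʳ (W (λ _ → 1ℚ) 0 ε′) _ _
    (trans (dual _) (sym (trans (cong (W (λ _ → 1ℚ) c ε ⊞_) size) (dual₀ _))))

-- The list of optimal words and the induction

-- After `p` full columns, `L₂` has `d` columns that lack just the cell in the top row, and `L₃` has
-- a triangle of side 2. The forms overlap, for instance at `d` = 0 or 1, so the case analyses below
-- may pass from one to another.
data LForm : Word → Set where
  L₁₀ : ∀ p n → LForm (ones p (zeros n []))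
  L₁  : ∀ p x y → LForm (ones p (zeros x (true ∷ zeros y [])))
  L₂  : ∀ p d y → d ≤ 2 + y → LForm (ones p (false ∷ ones d (zeros y [])))
  L₃  : ∀ p x → LForm (ones p (zeros x (true ∷ true ∷ [])))

CForm : Word → Set
CForm ε = LForm (complement ε)

LForm-1∷ : ∀ {ε} → LForm ε → LForm (true ∷ ε)
LForm-1∷ (L₁₀ p n)     = L₁₀ (suc p) n
LForm-1∷ (L₁ p x y)    = L₁ (suc p) x y
LForm-1∷ (L₂ p d y d≤) = L₂ (suc p) d y d≤
LForm-1∷ (L₃ p x)      = L₃ (suc p) x

data Verdict (ε : Word) : Set where
  better : (∀ c → Gain c ε) → Verdict ε
  isL    : LForm ε → Verdict ε
  isC    : CForm ε → Verdict ε

isC-01 : ∀ p {ε η} → complement ε ≡ η → LForm (true ∷ zeros p η) → Verdict (false ∷ ones p ε)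
isC-01 p {ε} refl f = isC (subst (LForm ∘ (true ∷_)) (sym (complement-rep true p ε)) f)

-- If the 1s outnumber the zeros after them, the top row is shortened; otherwise the
-- partial column is moved to the row above the columns of maximal height.
gain-01*0*10* : ∀ p x y →
  (∀ c → Gain c (false ∷ ones (suc p) (zeros (suc x) (true ∷ zeros y [])))) ⊎ (x ≡ 0 × y ≡ 0)
gain-01*0*10* p x y with suc p ≤? y
... | yes p<y with ≤⇒∃ p<y
...   | k , refl = inj₁ (gain-column-to-row p x k)
gain-01*0*10* p x y | no p≮y with ≤⇒∃ (≰⇒> p≮y)
... | k , eq with k ≤? x
...   | yes k≤x with ≤⇒∃ k≤x
...     | l , refl = inj₁ (subst (λ m → ∀ c → Gain c (false ∷ ones m (zeros (suc x) (true ∷ zeros y [])))) eq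
                       (gain-short-column-to-row y k l))
gain-01*0*10* p x y | no p≮y | k , eq | no k≰x with ≤⇒∃ (≰⇒> k≰x)
... | l , refl = wide x y eq
  where
  wide : ∀ x y → suc y + (suc x + l) ≡ suc p →
    (∀ c → Gain c (false ∷ ones (suc p) (zeros (suc x) (true ∷ zeros y [])))) ⊎ (x ≡ 0 × y ≡ 0)
  wide x (suc y) eq = inj₁ (gain-∷ false (subst (λ ε → ∀ c → Gain c ε)
    (trans (sym (rep-+ true (2 + l) (suc (x + y)) _)) (cong (λ m → ones m (zeros (suc x) (true ∷ zeros (suc y) []))) (trans (eq₁ l x y) eq)))
    (gain-rep true (2 + l) (gain-top-row x y))))
    where
    eq₁ : ∀ l x y → 2 + l + suc (x + y) ≡ suc (suc y) + (suc x + l)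
    eq₁ = solve-∀
  wide (suc r) zero eq = inj₁ (gain-∷ false (subst (λ ε → ∀ c → Gain c ε)
    (trans (sym (rep-+ true (1 + l) (2 + r) _)) (cong (λ m → ones m (zeros (2 + r) (true ∷ []))) (trans (eq₁ l r) eq)))
    (gain-rep true (1 + l) (gain-top-row-1 r))))
    where
    eq₁ : ∀ l r → 1 + l + (2 + r) ≡ 1 + (suc (suc r) + l)
    eq₁ = solve-∀
  wide zero zero eq = inj₂ (refl , refl)

-- When `p` exceeds `q + 2`, moving the row as in `gain-top-row-0` requires three zeros. For `q` up
-- to 2 the complement 1 0^p 1^q is itself a form of 𝓛.
verdict-L₁₀ : ∀ p q → Verdict (false ∷ ones p (zeros q []))
verdict-L₁₀ 0 q = isL (L₁₀ 0 (suc q))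
verdict-L₁₀ 1 q = isL (L₁ 0 1 q)
verdict-L₁₀ p@(suc (suc _)) q with p ≤? 2 + q
... | yes p≤ = isL (L₂ 0 p q p≤)
... | no  p≰ = wide q (≰⇒> p≰)
  where
  wide : ∀ q → 2 + q < p → Verdict (false ∷ ones p (zeros q []))
  wide 0 _ = isC-01 p refl (L₁₀ 1 p)
  wide 1 _ = isC-01 p refl (L₁ 1 p 0)
  wide 2 _ = isC-01 p refl (L₃ 1 p)
  wide (suc (suc (suc r))) q<p with ≤⇒∃ q<p
  ... | k , eq = better (gain-∷ false (subst (λ ε → ∀ c → Gain c ε)
    (trans (sym (rep-+ true (3 + k) (3 + r) _)) (cong (λ m → ones m (zeros (3 + r) [])) (trans (eq₁ k r) eq)))
    (gain-rep true (3 + k) (gain-top-row-0 r))))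
    where
    eq₁ : ∀ k r → 3 + k + (3 + r) ≡ suc (2 + (3 + r)) + k
    eq₁ = solve-∀

verdict-L₁ : ∀ p x y → Verdict (false ∷ ones p (zeros x (true ∷ zeros y [])))
verdict-L₁ zero    x       y = isL (L₁ 0 (suc x) y)
verdict-L₁ (suc p) zero    y = subst (Verdict ∘ (false ∷_)) (sym (rep-∷ true (suc p) _)) (verdict-L₁₀ (2 + p) y)
verdict-L₁ (suc p) (suc x) y with gain-01*0*10* p x y
... | inj₁ g             = better g
... | inj₂ (refl , refl) = isC-01 (suc p) refl (L₁ 1 (suc p) 1)

verdict-L₂ : ∀ p d y → d ≤ 2 + y → Verdict (false ∷ ones p (false ∷ ones d (zeros y [])))
verdict-L₂ p 0             y d≤ = verdict-L₁₀ p (suc y)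
verdict-L₂ p 1             y d≤ = verdict-L₁ p 1 y
verdict-L₂ p (suc (suc e)) y d≤ with ≤⇒∃ (≤-pred (≤-pred d≤))
... | suc j , refl with gain-01*0*10* (p + e) (suc e) j
-- The tied word has `2 + e` zeros before its partial column, so the exceptional outcome of one zero
-- cannot occur.
...   | inj₁ g = better (tied-gain (tied-∷ false (tied-rep true p t))
                   (subst (λ ε → ∀ c → Gain c (false ∷ ε))
                     (trans (cong (λ n → ones n (zeros (2 + e) (true ∷ zeros j []))) (sym (+-suc p e))) (rep-+ true p (suc e) _)) g))
  where
  t : Tied (false ∷ ones (2 + e) (zeros (e + suc j) [])) (ones (suc e) (zeros (2 + e) (true ∷ zeros j [])))
  t = subst (λ n → Tied (false ∷ ones (2 + e) (zeros n [])) (ones (suc e) (zeros (2 + e) (true ∷ zeros j []))))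
        (sym (+-suc e j)) (tied-L₂ (suc e) j)
-- Now d = y + 2 and the tied word has no partial column, so this boundary case is settled directly:
-- by the diagonal exchange if a full column precedes, otherwise by complementing small words and
-- moving a row in the large ones.
verdict-L₂ p (suc (suc e)) y d≤ | zero , eq = subst (λ y → Verdict (false ∷ ones p (false ∷ ones (2 + e) (zeros y []))))
    (trans (sym (+-identityʳ e)) eq) (exact p e)
  where
  exact : ∀ p e → Verdict (false ∷ ones p (false ∷ ones (2 + e) (zeros e [])))
  exact p       0       = isC-01 p refl (L₁ 1 p 2)
  exact (suc p) (suc r) = subst (Verdict ∘ (false ∷_)) (rep-∷ true p _)
    (better (gain-∷ false (gain-rep true p (gain-diagonal r))))
  exact zero 1 = isC (L₁ 2 3 0)
  exact zero 2 = isC (L₃ 2 4)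
  exact zero (suc (suc (suc r))) = better (gain-∷ false (gain-∷ false (gain-rep true 2 (gain-top-row-0 r))))

verdict-L₃ : ∀ p x → Verdict (false ∷ ones p (zeros x (true ∷ true ∷ [])))
verdict-L₃ zero    x = isL (L₃ 0 (suc x))
verdict-L₃ (suc p) 0 = isC-01 (suc p) refl (subst LForm (cong (true ∷_) (rep-+ false (suc p) 2 [])) (L₁₀ 1 (suc p + 2)))
verdict-L₃ (suc p) 1 = isC-01 (suc p) refl (L₁ 1 (suc p) 2)
-- The triangle is traded for a column of three cells, so two zeros follow the last 1 and the
-- exceptional outcome is excluded.
verdict-L₃ (suc p) (suc (suc x)) with gain-01*0*10* p x 2
... | inj₁ g = better (tied-gain (tied-∷ false (tied-rep true (suc p) (tied-L₃ (suc x)))) g)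

verdict-0∷ : ∀ {ε} → LForm ε → Verdict (false ∷ ε)
verdict-0∷ (L₁₀ p n)     = verdict-L₁₀ p n
verdict-0∷ (L₁ p x y)    = verdict-L₁ p x y
verdict-0∷ (L₂ p d y d≤) = verdict-L₂ p d y d≤
verdict-0∷ (L₃ p x)      = verdict-L₃ p x

optimal-0∷L : ∀ {w N c ε} → IncreasingBelow N w → c + (suc (length ε) + suc (length ε)) ≤ suc N →
  LForm ε → Optimal w c (false ∷ ε) → LForm (false ∷ ε) ⊎ CForm (false ∷ ε)
optimal-0∷L inc c≤N f opt with verdict-0∷ f
... | better g = ⊥-elim (gain⇒¬optimal inc c≤N (g _) opt)
... | isL l    = inj₁ l
... | isC l    = inj₂ l

-- Prefixing `b` changes size and weight by amounts that depend only on the length of the tail, so a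
-- better tail would give a better word.
optimal-tail : ∀ {w c} b {ε} → Optimal w c (b ∷ ε) → Σ ℕ (λ d → d + (length ε + length ε) ≤ c + (suc (length ε) + suc (length ε)) × Optimal w d ε)
optimal-tail {w} {c} true {ε} opt = 2 + c , ≤-reflexive (eq c (length ε)) , λ ε′ len size →
  ⊞-cancelˡ-≤ (seg w c (suc (length ε)))
    (subst (λ n → seg w c (suc n) ⊞ W w (2 + c) ε′ ≤ℚ seg w c (suc (length ε)) ⊞ W w (2 + c) ε) len
      (opt (true ∷ ε′) (cong suc len) (cong₂ (λ n v → seg (λ _ → 1ℚ) c (suc n) ⊞ v) len size)))
  where
  eq : ∀ c n → 2 + c + (n + n) ≡ c + (suc n + suc n)
  eq = solve-∀
optimal-tail {w} {c} false {ε} opt = c , +-monoʳ-≤ c (+-mono-≤ (n≤1+n _) (n≤1+n _)) ,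
  λ ε′ len size → opt (false ∷ ε′) (cong suc len) size

optimal⇒form : ∀ {w N} → IncreasingBelow N w → ∀ c ε → c + (length ε + length ε) ≤ suc N → Optimal w c ε → LForm ε ⊎ CForm ε
optimal⇒form inc c [] c≤N opt = inj₁ (L₁₀ 0 0)
optimal⇒form {w} {N} inc c (b ∷ ε) c≤N opt with optimal-tail b opt
... | d , d≤ , opt′ with b | optimal⇒form inc d ε (≤-trans d≤ c≤N) opt′
...   | true  | inj₁ f = inj₁ (LForm-1∷ f)
...   | false | inj₂ f = inj₂ (LForm-1∷ f)
...   | false | inj₁ f = optimal-0∷L inc c≤N f opt
-- The complement reads 0 followed by a form of 𝓛 and is optimal for the reflected weight; the lists
-- are swapped on return.
...   | true  | inj₂ f = swap (subst (λ η → LForm (complement (true ∷ ε)) ⊎ LForm (true ∷ η)) (complement-involutive ε)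
    (optimal-0∷L (increasing-reflect inc′) bound f (optimal-complement N′ (true ∷ ε) (eq c (length ε)) opt)))
  where
  -- The first rank beyond the present triangle, possibly below `N`: reflecting here gives the
  -- mirrored triangle corner rank 0.
  N′ = c + suc (length ε + length ε)
  eq : ∀ c n → c + (suc n + suc n) ≡ suc (c + suc (n + n))
  eq = solve-∀
  inc′ : IncreasingBelow N′ w
  inc′ i j i<j j<N′ = inc i j i<j (≤-trans j<N′ (≤-pred (subst (_≤ suc N) (eq c (length ε)) c≤N)))
  bound : suc (length (complement ε)) + suc (length (complement ε)) ≤ suc N′
  bound = subst (λ n → suc n + suc n ≤ suc N′) (sym (length-map not ε))
    (≤-trans (m≤n+m _ c) (≤-reflexive (eq c (length ε))))

-- Sums over the triangle

sumℚ : List ℚ → ℚ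
sumℚ = foldr _⊞_ 0ℚ

tri : (Pt → ℚ) → ℕ → ℚ
tri g n = sumℚ (map g (Rlist n))

sumℚ-++ : ∀ xs ys → sumℚ (xs ++ ys) ≡ sumℚ xs ⊞ sumℚ ys
sumℚ-++ []       ys = sym (⊞-identityˡ _)
sumℚ-++ (x ∷ xs) ys = trans (cong (x ⊞_) (sumℚ-++ xs ys)) (sym (⊞-assoc _ _ _))

sumℚ-upTo : ∀ f n → sumℚ (map f (upTo n)) ≡ seg f 0 n
sumℚ-upTo f n = trans (cong sumℚ (map-applyUpTo (λ i → i) f n)) (go f n)
  where
  go : ∀ f n → sumℚ (applyUpTo f n) ≡ seg f 0 n
  go f zero    = refl
  go f (suc n) = cong (f 0 ⊞_) (trans (go (f ∘ suc) n) (seg-cong 0 1 n (λ _ _ → refl)))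

row : ℕ → List Pt
row b = map (λ a → a , b) (upTo (suc b))

Rlist-suc : ∀ n → Rlist (suc n) ≡ Rlist n ++ row n
Rlist-suc n = begin
  concat (map row (upTo (suc n)))                 ≡⟨ cong (concat ∘ map row) (upTo-∷ʳ n) ⟨
  concat (map row (upTo n ++ n ∷ []))             ≡⟨ cong concat (map-++ row (upTo n) (n ∷ [])) ⟩
  concat (map row (upTo n) ++ row n ∷ [])         ≡⟨ concat-++ (map row (upTo n)) (row n ∷ []) ⟨
  Rlist n ++ (row n ++ [])                        ≡⟨ cong (Rlist n ++_) (++-identityʳ (row n)) ⟩
  Rlist n ++ row n                                ∎

tri-row : ∀ g n → tri g (suc n) ≡ tri g n ⊞ seg (λ a → g (a , n)) 0 (suc n)
tri-row g n = begin
  sumℚ (map g (Rlist (suc n)))                    ≡⟨ cong (sumℚ ∘ map g) (Rlist-suc n) ⟩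
  sumℚ (map g (Rlist n ++ row n))                 ≡⟨ cong sumℚ (map-++ g (Rlist n) (row n)) ⟩
  sumℚ (map g (Rlist n) ++ map g (row n))         ≡⟨ sumℚ-++ (map g (Rlist n)) (map g (row n)) ⟩
  tri g n ⊞ sumℚ (map g (row n))                  ≡⟨ cong (λ xs → tri g n ⊞ sumℚ xs) (map-∘ (upTo (suc n))) ⟨
  tri g n ⊞ sumℚ (map (λ a → g (a , n)) (upTo (suc n))) ≡⟨ cong (tri g n ⊞_) (sumℚ-upTo (λ a → g (a , n)) (suc n)) ⟩
  tri g n ⊞ seg (λ a → g (a , n)) 0 (suc n)       ∎

tri-cong : ∀ {g h} n → (∀ a b → a ≤ b → b < n → g (a , b) ≡ h (a , b)) → tri g n ≡ tri h n
tri-cong zero    eq = refl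
tri-cong {g} {h} (suc n) eq = begin
  tri g (suc n)
    ≡⟨ tri-row g n ⟩
  tri g n ⊞ seg (λ a → g (a , n)) 0 (suc n)
    ≡⟨ cong₂ _⊞_ (tri-cong n (λ a b a≤b b<n → eq a b a≤b (≤-trans b<n (n≤1+n n))))
         (seg-cong 0 0 (suc n) (λ a a<sn → eq a n (≤-pred a<sn) ≤-refl)) ⟩
  tri h n ⊞ seg (λ a → h (a , n)) 0 (suc n)
    ≡⟨ tri-row h n ⟨
  tri h (suc n) ∎

-- `Rlist` enumerates by rows, whereas the letter 1 splits off a column; adding one row at a time
-- rearranges the sum.
tri-column : ∀ g n → tri g (suc n) ≡ seg (λ b → g (0 , b)) 0 (suc n) ⊞ tri (λ { (a , b) → g (suc a , suc b) }) n
tri-column g zero    = sym (⊞-identityʳ _)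
tri-column g (suc n) = begin
  tri g (2 + n)
    ≡⟨ tri-row g (suc n) ⟩
  tri g (suc n) ⊞ (g (0 , suc n) ⊞ seg (λ a → g (a , suc n)) 1 (suc n))
    ≡⟨ cong₂ (λ u v → u ⊞ (g (0 , suc n) ⊞ v)) (tri-column g n) (seg-cong 1 0 (suc n) (λ _ _ → refl)) ⟩
  (seg (λ b → g (0 , b)) 0 (suc n) ⊞ tri g⁺ n) ⊞ (g (0 , suc n) ⊞ seg (λ a → g⁺ (a , n)) 0 (suc n))
    ≡⟨ solve 4 (λ a b c d → ((a ⊕ b) ⊕ (c ⊕ d)) ⊜ ((a ⊕ c) ⊕ (b ⊕ d))) refl
         (seg (λ b → g (0 , b)) 0 (suc n)) (tri g⁺ n) (g (0 , suc n)) (seg (λ a → g⁺ (a , n)) 0 (suc n)) ⟩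
  (seg (λ b → g (0 , b)) 0 (suc n) ⊞ g (0 , suc n)) ⊞ (tri g⁺ n ⊞ seg (λ a → g⁺ (a , n)) 0 (suc n))
    ≡⟨ cong₂ _⊞_ (seg-∷ʳ (λ b → g (0 , b)) 0 (suc n)) (tri-row g⁺ n) ⟨
  seg (λ b → g (0 , b)) 0 (2 + n) ⊞ tri g⁺ (suc n) ∎
  where
  g⁺ : Pt → ℚ
  g⁺ (a , b) = g (suc a , suc b)

-- Words as downsets of ℛ

shape : Word → Pt → Bool
shape []          x               = false
shape (true ∷ ε)  (zero , b)      = b <ᵇ suc (length ε)
shape (true ∷ ε)  (suc a , zero)  = false
shape (true ∷ ε)  (suc a , suc b) = shape ε (a , b)
shape (false ∷ ε) x               = shape ε x

<ᵇ-true : ∀ {m n} → m < n → (m <ᵇ n) ≡ true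
<ᵇ-true m<n = Equivalence.to T-≡ (<⇒<ᵇ m<n)

<ᵇ-true⁻¹ : ∀ m n → (m <ᵇ n) ≡ true → m < n
<ᵇ-true⁻¹ m n eq = <ᵇ⇒< m n (Equivalence.from T-≡ eq)

shape⇒inR : ∀ ε x → shape ε x ≡ true → inR (length ε) x
shape⇒inR (true ∷ ε)  (zero , b)      eq = z≤n , <ᵇ-true⁻¹ b _ eq
shape⇒inR (true ∷ ε)  (suc a , suc b) eq with shape⇒inR ε (a , b) eq
... | a≤b , b<n = s≤s a≤b , s≤s b<n
shape⇒inR (false ∷ ε) x               eq with shape⇒inR ε x eq
... | a≤b , b<n = a≤b , ≤-trans b<n (n≤1+n _)

shape-∉ : ∀ ε a b → length ε ≤ b → shape ε (a , b) ≡ false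
shape-∉ ε a b n≤b with shape ε (a , b) in eq
... | false = refl
... | true  = ⊥-elim (<⇒≱ (proj₂ (shape⇒inR ε (a , b) eq)) n≤b)

shape-down : ∀ ε a b c d → a ≤ b → a ≤ c → b ≤ d → shape ε (c , d) ≡ true → shape ε (a , b) ≡ true
shape-down (true ∷ ε) zero b c d _ _ b≤d eq = <ᵇ-true (≤-trans (s≤s b≤d) (proj₂ (shape⇒inR (true ∷ ε) (c , d) eq)))
shape-down (true ∷ ε) (suc a) (suc b) (suc c) (suc d) (s≤s a≤b) (s≤s a≤c) (s≤s b≤d) eq = shape-down ε a b c d a≤b a≤c b≤d eq
shape-down (false ∷ ε) a b c d a≤b a≤c b≤d eq = shape-down ε a b c d a≤b a≤c b≤d eq

shape-isDownset : ∀ ε → IsDownset (length ε) (shape ε)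
shape-isDownset ε = shape⇒inR ε , λ a b c d x∈R a≤c b≤d → shape-down ε a b c d (proj₁ x∈R) a≤c b≤d

tri-shape : ∀ w c ε → tri (λ x → if shape ε x then w (c + rank x) else 0ℚ) (length ε) ≡ W w c ε
tri-shape w c []          = refl
tri-shape w c (true ∷ ε)  = begin
  tri g (suc n)
    ≡⟨ tri-column g n ⟩
  seg (λ b → g (0 , b)) 0 (suc n) ⊞ tri (λ { (a , b) → g (suc a , suc b) }) n
    ≡⟨ cong₂ _⊞_
         (seg-cong 0 c (suc n) (λ b b<n → cong (λ t → if t then w (c + b) else 0ℚ) (<ᵇ-true b<n)))
         (tri-cong n (λ a b _ _ → cong (λ r → if shape ε (a , b) then w r else 0ℚ) (eq c a b))) ⟩
  seg w c (suc n) ⊞ tri (λ x → if shape ε x then w (2 + c + rank x) else 0ℚ) n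
    ≡⟨ cong (seg w c (suc n) ⊞_) (tri-shape w (2 + c) ε) ⟩
  W w c (true ∷ ε) ∎
  where
  n = length ε
  g : Pt → ℚ
  g x = if shape (true ∷ ε) x then w (c + rank x) else 0ℚ
  eq : ∀ c a b → c + (suc a + suc b) ≡ 2 + c + (a + b)
  eq = solve-∀
tri-shape w c (false ∷ ε) = begin
  tri g (suc n)
    ≡⟨ tri-row g n ⟩
  tri g n ⊞ seg (λ a → g (a , n)) 0 (suc n)
    ≡⟨ cong₂ _⊞_ (tri-shape w c ε)
         (trans (seg-cong 0 0 (suc n) (λ a _ → cong (λ t → if t then w (c + (a + n)) else 0ℚ) (shape-∉ ε a n ≤-refl)))
                (seg-0 0 (suc n))) ⟩
  W w c ε ⊞ 0ℚ
    ≡⟨ ⊞-identityʳ _ ⟩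
  W w c ε ∎
  where
  n = length ε
  g : Pt → ℚ
  g x = if shape ε x then w (c + rank x) else 0ℚ
  seg-0 : ∀ i m → seg (λ _ → 0ℚ) i m ≡ 0ℚ
  seg-0 i zero    = refl
  seg-0 i (suc m) = trans (⊞-identityˡ _) (seg-0 (suc i) m)

-- The cell (0, ℓ) dominates all of column 0 and is dominated by all of row ℓ, so its membership
-- fills the one or empties the other.
downset-shape : ∀ ℓ A → IsDownset ℓ A → Σ Word (λ ε → length ε ≡ ℓ × (∀ x → A x ≡ shape ε x))
downset-shape zero A (A⊆R , _) = [] , refl , empty
  where
  empty : ∀ x → A x ≡ false
  empty x with A x in eq
  ... | false = refl
  ... | true with A⊆R x eq
  ...   | _ , ()
downset-shape (suc ℓ) A (A⊆R , down) with A (0 , ℓ) in A0ℓ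
... | true = extend (downset-shape ℓ (λ { (a , b) → A (suc a , suc b) }) (sub , down⁺))
  where
  sub : ∀ x → A (suc (proj₁ x) , suc (proj₂ x)) ≡ true → inR ℓ x
  sub (a , b) eq with A⊆R _ eq
  ... | s≤s a≤b , s≤s b<ℓ = a≤b , b<ℓ
  down⁺ : ∀ a b c d → inR ℓ (a , b) → a ≤ c → b ≤ d → A (suc c , suc d) ≡ true → A (suc a , suc b) ≡ true
  down⁺ a b c d (a≤b , b<ℓ) a≤c b≤d = down _ _ _ _ (s≤s a≤b , s≤s b<ℓ) (s≤s a≤c) (s≤s b≤d)
  column : ∀ b → A (0 , b) ≡ (b <ᵇ suc ℓ)
  column b with b <ᵇ suc ℓ in b<ℓ
  ... | true = down 0 b 0 ℓ (z≤n , <ᵇ-true⁻¹ b _ b<ℓ) z≤n (≤-pred (<ᵇ-true⁻¹ b _ b<ℓ)) A0ℓ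
  ... | false with A (0 , b) in A0b
  ...   | false = refl
  ...   | true with trans (sym b<ℓ) (<ᵇ-true (proj₂ (A⊆R _ A0b)))
  ...     | ()
  corner : ∀ a → A (suc a , 0) ≡ false
  corner a with A (suc a , 0) in eq
  ... | false = refl
  ... | true with A⊆R _ eq
  ...   | () , _
  extend : Σ Word (λ ε → length ε ≡ ℓ × (∀ x → A (suc (proj₁ x) , suc (proj₂ x)) ≡ shape ε x)) →
    Σ Word (λ ε → length ε ≡ suc ℓ × (∀ x → A x ≡ shape ε x))
  extend (ε , refl , eq) = true ∷ ε , refl , λ
    { (zero , b)      → column b
    ; (suc a , zero)  → corner a
    ; (suc a , suc b) → eq (a , b) }
... | false = extend (downset-shape ℓ A (sub , λ a b c d x∈R → down a b c d (proj₁ x∈R , ≤-trans (proj₂ x∈R) (n≤1+n ℓ))))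
  where
  sub : ∀ x → A x ≡ true → inR ℓ x
  sub (a , b) eq with A⊆R _ eq
  ... | a≤b , b<sℓ with m≤n⇒m<n∨m≡n (≤-pred b<sℓ)
  ...   | inj₁ b<ℓ = a≤b , b<ℓ
  ...   | inj₂ refl with trans (sym A0ℓ) (down 0 ℓ a ℓ (z≤n , ≤-refl) z≤n ≤-refl eq)
  ...     | ()
  extend : Σ Word (λ ε → length ε ≡ ℓ × (∀ x → A x ≡ shape ε x)) → Σ Word (λ ε → length ε ≡ suc ℓ × (∀ x → A x ≡ shape ε x))
  extend (ε , len , eq) = false ∷ ε , cong suc len , eq

-- From optimal downsets to optimal words

-- Makes a size the weight under the constant weight 1, so that `tri-shape` serves for both;
-- injectivity leads back to ℕ.
fromℕ : ℕ → ℚ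
fromℕ zero    = 0ℚ
fromℕ (suc n) = 1ℚ ⊞ fromℕ n

opaque
  unfolding _⊞_
  0≤fromℕ : ∀ n → 0ℚ ≤ℚ fromℕ n
  0≤fromℕ zero    = ℚ.≤-refl
  0≤fromℕ (suc n) = ℚ.+-mono-≤ {0ℚ} {1ℚ} (ℚ.nonNegative⁻¹ 1ℚ) (0≤fromℕ n)

  0<fromℕ-suc : ∀ n → 0ℚ <ℚ fromℕ (suc n)
  0<fromℕ-suc n = ℚ.+-mono-<-≤ {0ℚ} {1ℚ} (ℚ.positive⁻¹ 1ℚ) (0≤fromℕ n)

  wtSum-⊞ : ∀ ℓ wt A → wtSum ℓ wt A ≡ tri (λ x → if A x then wt x else 0ℚ) ℓ
  wtSum-⊞ ℓ wt A = refl

fromℕ-injective : ∀ {m n} → fromℕ m ≡ fromℕ n → m ≡ n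
fromℕ-injective {zero}  {zero}  eq = refl
fromℕ-injective {zero}  {suc n} eq = ⊥-elim (ℚ.<-irrefl eq (0<fromℕ-suc n))
fromℕ-injective {suc m} {zero}  eq = ⊥-elim (ℚ.<-irrefl (sym eq) (0<fromℕ-suc m))
fromℕ-injective {suc m} {suc n} eq = cong suc (fromℕ-injective (⊞-cancelˡ 1ℚ _ _ eq))

fromℕ-size : ∀ ℓ A → fromℕ (size ℓ A) ≡ tri (λ x → if A x then 1ℚ else 0ℚ) ℓ
fromℕ-size ℓ A = go (Rlist ℓ)
  where
  go : ∀ xs → fromℕ (foldr _+_ 0 (map (λ x → if A x then 1 else 0) xs)) ≡ sumℚ (map (λ x → if A x then 1ℚ else 0ℚ) xs)
  go []       = refl
  go (x ∷ xs) with A x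
  ... | true  = cong (1ℚ ⊞_) (go xs)
  ... | false = trans (go xs) (sym (⊞-identityˡ _))

fromℕ-size-shape : ∀ c ε → fromℕ (size (length ε) (shape ε)) ≡ W (λ _ → 1ℚ) c ε
fromℕ-size-shape c ε = trans (fromℕ-size (length ε) (shape ε)) (tri-shape (λ _ → 1ℚ) c ε)

size-cong : ∀ ℓ {A B} → (∀ x → A x ≡ B x) → size ℓ A ≡ size ℓ B
size-cong ℓ eq = cong (foldr _+_ 0) (map-cong (λ x → cong (λ t → if t then 1 else 0) (eq x)) (Rlist ℓ))

wtSum-cong : ∀ ℓ wt {A B} → (∀ x → A x ≡ B x) → wtSum ℓ wt A ≡ wtSum ℓ wt B
wtSum-cong ℓ wt eq = cong (foldr _+ℚ_ 0ℚ) (map-cong (λ x → cong (λ t → if t then wt x else 0ℚ) (eq x)) (Rlist ℓ))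

-- (⌊r/2⌋, ⌈r/2⌉) lies in ℛ whenever some element of rank r does.
rankWeight : (Pt → ℚ) → ℕ → ℚ
rankWeight wt r = wt (⌊ r /2⌋ , ⌈ r /2⌉)

middle-inR : ∀ ℓ r → suc r < ℓ + ℓ → inR ℓ (⌊ r /2⌋ , ⌈ r /2⌉)
middle-inR ℓ r r<2ℓ = ⌊n/2⌋≤⌈n/2⌉ r , half
  where
  half : ⌊ suc r /2⌋ < ℓ
  half = ≰⇒> λ ℓ≤ → <⇒≱ r<2ℓ (≤-trans (+-mono-≤ ℓ≤ (≤-trans ℓ≤ (⌊n/2⌋≤⌈n/2⌉ (suc r)))) (≤-reflexive (⌊n/2⌋+⌈n/2⌉≡n (suc r))))

rank-middle : ∀ r → rank (⌊ r /2⌋ , ⌈ r /2⌉) ≡ r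
rank-middle = ⌊n/2⌋+⌈n/2⌉≡n

inR⇒rank : ∀ ℓ a b → a ≤ b → b < ℓ → suc (a + b) < ℓ + ℓ
inR⇒rank ℓ a b a≤b b<ℓ = subst (_≤ ℓ + ℓ) (cong suc (+-suc a b)) (+-mono-≤ (≤-trans (s≤s a≤b) b<ℓ) b<ℓ)

wtSum-shape : ∀ wt ε → RankConstant (length ε) wt → wtSum (length ε) wt (shape ε) ≡ W (rankWeight wt) 0 ε
wtSum-shape wt ε const = trans (wtSum-⊞ (length ε) wt (shape ε)) (trans
  (tri-cong (length ε) (λ a b a≤b b<ℓ → cong (λ v → if shape ε (a , b) then v else 0ℚ)
    (const (a , b) _ (a≤b , b<ℓ) (middle-inR _ (a + b) (inR⇒rank _ a b a≤b b<ℓ)) (sym (rank-middle (a + b))))))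
  (tri-shape (rankWeight wt) 0 ε))

rankWeight-increasing : ∀ ℓ wt N → suc N ≡ ℓ + ℓ → RankIncreasing ℓ wt → IncreasingBelow N (rankWeight wt)
rankWeight-increasing ℓ wt N eq inc i j i<j j<N = inc _ _
  (middle-inR ℓ i (subst (suc i <_) eq (s≤s (≤-trans i<j (<⇒≤ j<N))))) (middle-inR ℓ j (subst (suc j <_) eq (s≤s j<N)))
  (subst₂ _<_ (sym (rank-middle i)) (sym (rank-middle j)) i<j)

optimal-shape : ∀ wt ε → RankConstant (length ε) wt → ∀ A → IsOptimal (length ε) wt A → (∀ x → A x ≡ shape ε x) →
  Optimal (rankWeight wt) 0 ε
optimal-shape wt ε const A (_ , opt) A≡ ε′ len size-eq = subst₂ _≤ℚ_ lhs rhs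
  (opt (shape ε′) (subst (λ n → IsDownset n (shape ε′)) len (shape-isDownset ε′)) sizes)
  where
  sizes : size (length ε) (shape ε′) ≡ size (length ε) A
  sizes = fromℕ-injective (begin
    fromℕ (size (length ε) (shape ε′))  ≡⟨ cong (λ n → fromℕ (size n (shape ε′))) len ⟨
    fromℕ (size (length ε′) (shape ε′)) ≡⟨ fromℕ-size-shape 0 ε′ ⟩
    W (λ _ → 1ℚ) 0 ε′                   ≡⟨ size-eq ⟩
    W (λ _ → 1ℚ) 0 ε                    ≡⟨ fromℕ-size-shape 0 ε ⟨
    fromℕ (size (length ε) (shape ε))   ≡⟨ cong fromℕ (size-cong (length ε) A≡) ⟨
    fromℕ (size (length ε) A)           ∎)
  lhs : wtSum (length ε) wt (shape ε′) ≡ W (rankWeight wt) 0 ε′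
  lhs = trans (cong (λ n → wtSum n wt (shape ε′)) (sym len))
    (wtSum-shape wt ε′ (subst (λ n → RankConstant n wt) (sym len) const))
  rhs : wtSum (length ε) wt A ≡ W (rankWeight wt) 0 ε
  rhs = trans (wtSum-cong (length ε) wt A≡) (wtSum-shape wt ε const)

downset⇒form : ∀ ℓ wt → RankConstant (suc ℓ) wt → RankIncreasing (suc ℓ) wt → ∀ A → IsOptimal (suc ℓ) wt A →
  Σ Word (λ ε → length ε ≡ suc ℓ × (∀ x → A x ≡ shape ε x) × (LForm ε ⊎ CForm ε))
downset⇒form ℓ wt const inc A opt with downset-shape (suc ℓ) A (proj₁ opt)
... | ε , len , eq = ε , len , eq , optimal⇒form
  -- ℛ has the ranks 0, ..., 2ℓ, which are `ℓ + suc ℓ` many.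
  (rankWeight-increasing (suc ℓ) wt (ℓ + suc ℓ) refl inc) 0 ε
  (≤-reflexive (cong₂ _+_ len len))
  (optimal-shape wt ε (subst (λ n → RankConstant n wt) (sym len) const) A (subst (λ n → IsOptimal n wt A) (sym len) opt) eq)

-- Initial segments

Below : Order → Pt → Pt → Set
Below 𝓛 (a , b) (c , d) = a < c ⊎ (a ≡ c × b < d)
Below 𝓒 (a , b) (c , d) = b < d ⊎ (b ≡ d × a < c)

lex⇔ : ∀ a b c d → ((a <ᵇ c) ∨ ((a ≡ᵇ c) ∧ (b <ᵇ d))) ≡ true ⇔ (a < c ⊎ (a ≡ c × b < d))
lex⇔ a b c d = mk⇔
  (λ eq → case to (T-∨ {a <ᵇ c}) (from T-≡ eq) of λ
    { (inj₁ t) → inj₁ (<ᵇ⇒< a c t)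
    ; (inj₂ t) → inj₂ (≡ᵇ⇒≡ a c (proj₁ (to (T-∧ {a ≡ᵇ c}) t)) , <ᵇ⇒< b d (proj₂ (to (T-∧ {a ≡ᵇ c}) t))) })
  (λ { (inj₁ a<c)         → to T-≡ (from (T-∨ {a <ᵇ c}) (inj₁ (<⇒<ᵇ a<c)))
     ; (inj₂ (a≡c , b<d)) → to T-≡ (from (T-∨ {a <ᵇ c}) (inj₂ (from (T-∧ {a ≡ᵇ c}) (≡⇒≡ᵇ a c a≡c , <⇒<ᵇ b<d)))) })

<[]⇔Below : ∀ D x y → (x <[ D ] y) ≡ true ⇔ Below D x y
<[]⇔Below 𝓛 (a , b) (c , d) = lex⇔ a b c d
<[]⇔Below 𝓒 (a , b) (c , d) = lex⇔ b a d c

lex-irrefl : ∀ {a b : ℕ} → ¬ (a < a ⊎ (a ≡ a × b < b))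
lex-irrefl (inj₁ a<a)       = <-irrefl refl a<a
lex-irrefl (inj₂ (_ , b<b)) = <-irrefl refl b<b

Below-irrefl : ∀ D x → ¬ Below D x x
Below-irrefl 𝓛 x = lex-irrefl
Below-irrefl 𝓒 x = lex-irrefl

Below-total : ∀ D x y → Below D x y ⊎ x ≡ y ⊎ Below D y x
Below-total 𝓛 (a , b) (c , d) with <-cmp a c | <-cmp b d
... | tri< a<c _ _  | _             = inj₁ (inj₁ a<c)
... | tri> _ _ c<a  | _             = inj₂ (inj₂ (inj₁ c<a))
... | tri≈ _ refl _ | tri< b<d _ _  = inj₁ (inj₂ (refl , b<d))
... | tri≈ _ refl _ | tri≈ _ refl _ = inj₂ (inj₁ refl)
... | tri≈ _ refl _ | tri> _ _ d<b  = inj₂ (inj₂ (inj₂ (refl , d<b)))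
Below-total 𝓒 (a , b) (c , d) with <-cmp b d | <-cmp a c
... | tri< b<d _ _  | _             = inj₁ (inj₁ b<d)
... | tri> _ _ d<b  | _             = inj₂ (inj₂ (inj₁ d<b))
... | tri≈ _ refl _ | tri< a<c _ _  = inj₁ (inj₂ (refl , a<c))
... | tri≈ _ refl _ | tri≈ _ refl _ = inj₂ (inj₁ refl)
... | tri≈ _ refl _ | tri> _ _ c<a  = inj₂ (inj₂ (inj₂ (refl , c<a)))

Rlist⇒inR : ∀ {ℓ x} → x ∈ Rlist ℓ → inR ℓ x
Rlist⇒inR {ℓ} x∈ with ∈-concat⁻′ (map row (upTo ℓ)) x∈
... | _ , x∈row , row∈ with ∈-map⁻ row row∈
... | b , b∈ , refl with ∈-map⁻ (λ a → a , b) x∈row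
... | a , a∈ , refl = ≤-pred (∈-upTo⁻ a∈) , ∈-upTo⁻ b∈

inR⇒Rlist : ∀ {ℓ x} → inR ℓ x → x ∈ Rlist ℓ
inR⇒Rlist {ℓ} {a , b} (a≤b , b<ℓ) = ∈-concat⁺′ (∈-map⁺ (λ a → a , b) (∈-upTo⁺ (s≤s a≤b))) (∈-map⁺ row (∈-upTo⁺ b<ℓ))

count : (Pt → Bool) → List Pt → ℕ
count B xs = foldr _+_ 0 (map (λ x → if B x then 1 else 0) xs)

indicator-mono : ∀ s t → (s ≡ true → t ≡ true) → (if s then 1 else 0) ≤ (if t then 1 else 0)
indicator-mono false t     h = z≤n
indicator-mono true  true  h = ≤-refl
indicator-mono true  false h with h refl
... | ()

count-mono-≤ : ∀ A B xs → (∀ x → x ∈ xs → A x ≡ true → B x ≡ true) → count A xs ≤ count B xs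
count-mono-≤ A B []       h = z≤n
count-mono-≤ A B (x ∷ xs) h = +-mono-≤ (indicator-mono (A x) (B x) (h x (here refl)))
  (count-mono-≤ A B xs (λ y y∈ → h y (there y∈)))

count-mono-< : ∀ A B xs z → z ∈ xs → A z ≡ false → B z ≡ true →
  (∀ x → x ∈ xs → A x ≡ true → B x ≡ true) → count A xs < count B xs
count-mono-< A B (x ∷ xs) .x (here refl) ¬Ax Bx h rewrite ¬Ax | Bx = s≤s (count-mono-≤ A B xs (λ y y∈ → h y (there y∈)))
count-mono-< A B (x ∷ xs) z (there z∈) ¬Az Bz h = +-mono-≤-< (indicator-mono (A x) (B x) (h x (here refl)))
  (count-mono-< A B xs z z∈ ¬Az Bz (λ y y∈ → h y (there y∈)))

≢true⇒false : ∀ {b} → ¬ b ≡ true → b ≡ false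
≢true⇒false {false} _ = refl
≢true⇒false {true}  h = ⊥-elim (h refl)

inRᵇ⇔inR : ∀ ℓ x → inRᵇ ℓ x ≡ true ⇔ inR ℓ x
inRᵇ⇔inR ℓ (a , b) = mk⇔
  (λ eq → let t = to (T-∧ {a ≤ᵇ b}) (from T-≡ eq) in ≤ᵇ⇒≤ a b (proj₁ t) , <ᵇ⇒< b ℓ (proj₂ t))
  (λ { (a≤b , b<ℓ) → to T-≡ (from (T-∧ {a ≤ᵇ b}) (≤⇒≤ᵇ a≤b , <⇒<ᵇ b<ℓ)) })

-- If `x` lies in `B`, its predecessors form a subset of `B` that misses `x`, so there are fewer
-- than |B|. If not, totality and closure put all of `B` below `x`, so there are at least |B|.
closed⇒initSeg : ∀ ℓ D B → SubsetOfR ℓ B → (∀ x y → inR ℓ x → Below D x y → B y ≡ true → B x ≡ true) →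
  ∀ x → B x ≡ initSeg ℓ D (size ℓ B) x
closed⇒initSeg ℓ D B B⊆R closed x with B x in Bx
... | true = sym (cong₂ _∧_ (from (inRᵇ⇔inR ℓ x) (B⊆R x Bx)) (<ᵇ-true
  (count-mono-< (λ y → y <[ D ] x) B (Rlist ℓ) x (inR⇒Rlist (B⊆R x Bx))
    (≢true⇒false (λ x<x → Below-irrefl D x (to (<[]⇔Below D x x) x<x))) Bx
    (λ y y∈ y<x → closed y x (Rlist⇒inR y∈) (to (<[]⇔Below D y x) y<x) Bx))))
... | false with inRᵇ ℓ x in x∈R
...   | false = refl
...   | true  = sym (≢true⇒false (λ few → <⇒≱ (<ᵇ-true⁻¹ (countBelow ℓ D x) (size ℓ B) few)
    (count-mono-≤ B (λ y → y <[ D ] x) (Rlist ℓ) below)))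
  where
  below : ∀ y → y ∈ Rlist ℓ → B y ≡ true → (y <[ D ] x) ≡ true
  below y _ By with Below-total D y x
  ... | inj₁ y<x        = from (<[]⇔Below D y x) y<x
  ... | inj₂ (inj₁ refl) = case trans (sym Bx) By of λ ()
  ... | inj₂ (inj₂ x<y) = case trans (sym Bx) (closed x y (to (inRᵇ⇔inR ℓ x) x∈R) x<y By) of λ ()

Columns Rows : ℕ → ℕ → ℕ → Pt → Set
Columns ℓ p h (a , b) = inR ℓ (a , b) × (a < p ⊎ (a ≡ p × b < h))
Rows    ℓ k r (a , b) = inR ℓ (a , b) × (b < k ⊎ (b ≡ k × a < r))

columns⇒initSeg : ∀ ℓ p h B → (∀ x → B x ≡ true ⇔ Columns ℓ p h x) → ∀ x → B x ≡ initSeg ℓ 𝓛 (size ℓ B) x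
columns⇒initSeg ℓ p h B eq = closed⇒initSeg ℓ 𝓛 B (λ x Bx → proj₁ (to (eq x) Bx))
  (λ x y x∈R x<y By → from (eq x) (x∈R , lower x<y (proj₂ (to (eq y) By))))
  where
  lower : ∀ {x y} → Below 𝓛 x y → proj₁ y < p ⊎ (proj₁ y ≡ p × proj₂ y < h) → proj₁ x < p ⊎ (proj₁ x ≡ p × proj₂ x < h)
  lower (inj₁ a<c)          (inj₁ c<p)          = inj₁ (<-trans a<c c<p)
  lower (inj₁ a<c)          (inj₂ (refl , _))   = inj₁ a<c
  lower (inj₂ (refl , _))   (inj₁ c<p)          = inj₁ c<p
  lower (inj₂ (refl , b<d)) (inj₂ (refl , d<h)) = inj₂ (refl , <-trans b<d d<h)

rows⇒initSeg : ∀ ℓ k r B → (∀ x → B x ≡ true ⇔ Rows ℓ k r x) → ∀ x → B x ≡ initSeg ℓ 𝓒 (size ℓ B) x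
rows⇒initSeg ℓ k r B eq = closed⇒initSeg ℓ 𝓒 B (λ x Bx → proj₁ (to (eq x) Bx))
  (λ x y x∈R x<y By → from (eq x) (x∈R , lower x<y (proj₂ (to (eq y) By))))
  where
  lower : ∀ {x y} → Below 𝓒 x y → proj₂ y < k ⊎ (proj₂ y ≡ k × proj₁ y < r) → proj₂ x < k ⊎ (proj₂ x ≡ k × proj₁ x < r)
  lower (inj₁ b<d)          (inj₁ d<k)          = inj₁ (<-trans b<d d<k)
  lower (inj₁ b<d)          (inj₂ (refl , _))   = inj₁ b<d
  lower (inj₂ (refl , _))   (inj₁ d<k)          = inj₁ d<k
  lower (inj₂ (refl , a<c)) (inj₂ (refl , c<r)) = inj₂ (refl , <-trans a<c c<r)

-- The listed words in coordinates

shape-zeros : ∀ n ε x → shape (zeros n ε) x ≡ shape ε x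
shape-zeros zero    ε x = refl
shape-zeros (suc n) ε x = shape-zeros n ε x

shape-ones : ∀ p ε a b → shape (ones p ε) (a , b) ≡ true ⇔
  ((a < p × a ≤ b × b < p + length ε) ⊎ Σ ℕ (λ i → Σ ℕ (λ j → a ≡ p + i × b ≡ p + j × shape ε (i , j) ≡ true)))
shape-ones p ε a b = mk⇔ (go⇒ p a b) (go⇐ p a b)
  where
  go⇒ : ∀ p a b → shape (ones p ε) (a , b) ≡ true →
    (a < p × a ≤ b × b < p + length ε) ⊎ Σ ℕ (λ i → Σ ℕ (λ j → a ≡ p + i × b ≡ p + j × shape ε (i , j) ≡ true))
  go⇒ zero    a       b       eq = inj₂ (a , b , refl , refl , eq)
  go⇒ (suc p) zero    b       eq = inj₁ (s≤s z≤n , z≤n , subst (λ n → b < suc n) (length-rep true p ε) (<ᵇ-true⁻¹ b _ eq))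
  go⇒ (suc p) (suc a) (suc b) eq with go⇒ p a b eq
  ... | inj₁ (a<p , a≤b , b<n)          = inj₁ (s≤s a<p , s≤s a≤b , s≤s b<n)
  ... | inj₂ (i , j , refl , refl , eq′) = inj₂ (i , j , refl , refl , eq′)
  go⇐ : ∀ p a b → (a < p × a ≤ b × b < p + length ε) ⊎ Σ ℕ (λ i → Σ ℕ (λ j → a ≡ p + i × b ≡ p + j × shape ε (i , j) ≡ true)) →
    shape (ones p ε) (a , b) ≡ true
  go⇐ zero    a b       (inj₂ (i , j , refl , refl , eq)) = eq
  go⇐ (suc p) zero b    (inj₁ (_ , _ , b<n)) = <ᵇ-true (subst (λ n → b < suc n) (sym (length-rep true p ε)) b<n)
  go⇐ (suc p) (suc a) (suc b) (inj₁ (s≤s a<p , s≤s a≤b , s≤s b<n)) = go⇐ p a b (inj₁ (a<p , a≤b , b<n))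
  go⇐ (suc p) a b       (inj₂ (i , j , refl , refl , eq)) = go⇐ p (p + i) (p + j) (inj₂ (i , j , refl , refl , eq))

shape-ones⇐ˡ : ∀ p ε {a b} → a < p → inR (length (ones p ε)) (a , b) → shape (ones p ε) (a , b) ≡ true
shape-ones⇐ˡ p ε {a} {b} a<p (a≤b , b<ℓ) = from (shape-ones p ε a b) (inj₁ (a<p , a≤b , subst (b <_) (length-rep true p ε) b<ℓ))

shape-ones⇐ʳ : ∀ p ε i j → shape ε (i , j) ≡ true → shape (ones p ε) (p + i , p + j) ≡ true
shape-ones⇐ʳ p ε i j eq = from (shape-ones p ε (p + i) (p + j)) (inj₂ (i , j , refl , refl , eq))

shape-0* : ∀ n x → shape (zeros n []) x ≢ true
shape-0* n x eq with trans (sym (shape-zeros n [] x)) eq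
... | ()

shape-0*10*⇒ : ∀ x y i j → shape (zeros x (true ∷ zeros y [])) (i , j) ≡ true → i ≡ 0 × j < suc y
shape-0*10*⇒ x y zero j eq = refl ,
  subst (λ n → j < suc n) (length-0* y) (<ᵇ-true⁻¹ j _ (trans (sym (shape-zeros x (true ∷ zeros y []) (0 , j))) eq))
shape-0*10*⇒ x y (suc i) zero eq with trans (sym (shape-zeros x (true ∷ zeros y []) (suc i , zero))) eq
... | ()
shape-0*10*⇒ x y (suc i) (suc j) eq =
  ⊥-elim (shape-0* y (i , j) (trans (sym (shape-zeros x (true ∷ zeros y []) (suc i , suc j))) eq))

shape-0*10*⇐ : ∀ x y j → j < suc y → shape (zeros x (true ∷ zeros y [])) (0 , j) ≡ true
shape-0*10*⇐ x y j j<y = trans (shape-zeros x (true ∷ zeros y []) (0 , j))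
  (<ᵇ-true (subst (λ n → j < suc n) (sym (length-0* y)) j<y))

shape-1* : ∀ n a b → shape (ones n []) (a , b) ≡ true ⇔ (a ≤ b × b < n)
shape-1* n a b = mk⇔
  (λ eq → case to (shape-ones n [] a b) eq of λ { (inj₁ (_ , a≤b , b<n)) → a≤b , subst (b <_) (+-identityʳ n) b<n })
  (λ { (a≤b , b<n) → from (shape-ones n [] a b) (inj₁ (≤-<-trans a≤b b<n , a≤b , subst (b <_) (sym (+-identityʳ n)) b<n)) })

shape-L₁₀ : ∀ p n x → shape (ones p (zeros n [])) x ≡ true ⇔ Columns (length (ones p (zeros n []))) p p x
shape-L₁₀ p n (a , b) = mk⇔
  (λ eq → shape⇒inR (ones p (zeros n [])) (a , b) eq , (case to (shape-ones p _ a b) eq of λ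
    { (inj₁ (a<p , _))            → inj₁ a<p
    ; (inj₂ (i , j , _ , _ , eq)) → ⊥-elim (shape-0* n (i , j) eq) }))
  (λ { (x∈R , inj₁ a<p)            → shape-ones⇐ˡ p _ a<p x∈R
     -- Column `p` of ℛ begins at height `p`, so height bound `p` means an empty partial column.
     ; (x∈R , inj₂ (refl , b<p)) → ⊥-elim (<⇒≱ b<p (proj₁ x∈R)) })

shape-L₁ : ∀ p x y z → shape (ones p (zeros x (true ∷ zeros y []))) z ≡ true ⇔
  Columns (length (ones p (zeros x (true ∷ zeros y [])))) p (p + suc y) z
shape-L₁ p x y (a , b) = mk⇔
  (λ eq → shape⇒inR (ones p (zeros x (true ∷ zeros y []))) (a , b) eq , (case to (shape-ones p _ a b) eq of λ
    { (inj₁ (a<p , _))                  → inj₁ a<p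
    ; (inj₂ (i , j , refl , refl , eq)) → inj₂ (case shape-0*10*⇒ x y i j eq of λ
        { (refl , j<y) → +-identityʳ p , +-monoʳ-< p j<y }) }))
  (λ { (x∈R , inj₁ a<p)            → shape-ones⇐ˡ p _ a<p x∈R
     ; (x∈R , inj₂ (refl , b<h)) → partial (proj₁ x∈R) b<h })
  where
  partial : a ≤ b → b < a + suc y → shape (ones a (zeros x (true ∷ zeros y []))) (a , b) ≡ true
  partial a≤b b<h with ≤⇒∃ a≤b
  ... | j , refl = subst (λ i → shape (ones a (zeros x (true ∷ zeros y []))) (i , a + j) ≡ true) (+-identityʳ a)
    (shape-ones⇐ʳ a _ 0 j (shape-0*10*⇐ x y j (+-cancelˡ-< a _ _ b<h)))

-- The bound `p + suc y + e` is the index of the top row, the only row missing from columns `p` to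
-- `p + e`.
shape-L₂ : ∀ p e y a b → shape (ones p (false ∷ ones (suc e) (zeros y []))) (a , b) ≡ true ⇔
  (inR (length (ones p (false ∷ ones (suc e) (zeros y [])))) (a , b) × (a < p ⊎ (a ≤ p + e × b < p + suc y + e)))
shape-L₂ p e y a b = mk⇔
  (λ eq → shape⇒inR (ones p (false ∷ ones (suc e) (zeros y []))) (a , b) eq , (case to (shape-ones p _ a b) eq of λ
    { (inj₁ (a<p , _))                  → inj₁ a<p
    ; (inj₂ (i , j , refl , refl , eq)) → inj₂ (case to (shape-ones (suc e) (zeros y []) i j) eq of λ
        { (inj₁ (s≤s i≤e , _ , j<n))   → +-monoʳ-≤ p i≤e ,
            subst (p + j <_) (trans (cong (λ m → p + (suc e + m)) (length-0* y)) (eq₁ p e y)) (+-monoʳ-< p j<n)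
        ; (inj₂ (i , j , _ , _ , eq)) → ⊥-elim (shape-0* y (i , j) eq) }) }))
  (λ { (x∈R , inj₁ a<p)              → shape-ones⇐ˡ p _ a<p x∈R
     ; (x∈R , inj₂ (a≤p+e , b<h)) → partial x∈R a≤p+e b<h })
  where
  eq₁ : ∀ p e y → p + (suc e + y) ≡ p + suc y + e
  eq₁ = solve-∀
  partial : inR (length (ones p (false ∷ ones (suc e) (zeros y [])))) (a , b) → a ≤ p + e → b < p + suc y + e →
    shape (ones p (false ∷ ones (suc e) (zeros y []))) (a , b) ≡ true
  partial x∈R a≤ b< with p ≤? a
  ... | no  p≰a = shape-ones⇐ˡ p _ (≰⇒> p≰a) x∈R
  ... | yes p≤a with ≤⇒∃ p≤a | ≤⇒∃ (≤-trans p≤a (proj₁ x∈R))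
  ...   | i , refl | j , refl = shape-ones⇐ʳ p _ i j (from (shape-ones (suc e) (zeros y []) i j)
    (inj₁ (s≤s (+-cancelˡ-≤ p _ _ a≤) , +-cancelˡ-≤ p _ _ (proj₁ x∈R) ,
      +-cancelˡ-< p _ _ (subst (p + j <_) (sym (trans (cong (λ m → p + (suc e + m)) (length-0* y)) (eq₁ p e y))) b<))))

shape-L₃ : ∀ p x a b → shape (ones p (zeros x (true ∷ true ∷ []))) (a , b) ≡ true ⇔
  (inR (length (ones p (zeros x (true ∷ true ∷ [])))) (a , b) × (a < p ⊎ (a ≡ p × b < p + 2) ⊎ (a ≡ p + 1 × b ≡ p + 1)))
shape-L₃ p x a b = mk⇔
  (λ eq → shape⇒inR (ones p (zeros x (true ∷ true ∷ []))) (a , b) eq , (case to (shape-ones p _ a b) eq of λ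
    { (inj₁ (a<p , _))                  → inj₁ a<p
    ; (inj₂ (i , j , refl , refl , eq)) → inj₂ (small⇒ i j (trans (sym (shape-zeros x _ (i , j))) eq)) }))
  (λ { (x∈R , inj₁ a<p)                   → shape-ones⇐ˡ p _ a<p x∈R
     ; (x∈R , inj₂ (inj₁ (refl , b<h)))   → partial (proj₁ x∈R) b<h
     ; (x∈R , inj₂ (inj₂ (refl , refl))) → shape-ones⇐ʳ p _ 1 1 (shape-zeros x _ (1 , 1)) })
  where
  small⇒ : ∀ i j → shape (true ∷ true ∷ []) (i , j) ≡ true → (p + i ≡ p × p + j < p + 2) ⊎ (p + i ≡ p + 1 × p + j ≡ p + 1)
  small⇒ zero          j             eq = inj₁ (+-identityʳ p , +-monoʳ-< p (<ᵇ-true⁻¹ j 2 eq))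
  small⇒ (suc zero)    (suc zero)    eq = inj₂ (refl , refl)
  small⇒ (suc zero)    (suc (suc j)) ()
  small⇒ (suc (suc i)) (suc (suc j)) ()
  partial : a ≤ b → b < a + 2 → shape (ones a (zeros x (true ∷ true ∷ []))) (a , b) ≡ true
  partial a≤b b<h with ≤⇒∃ a≤b
  ... | j , refl = subst (λ i → shape (ones a (zeros x (true ∷ true ∷ []))) (i , a + j) ≡ true) (+-identityʳ a)
    (shape-ones⇐ʳ a _ 0 j (trans (shape-zeros x _ (0 , j)) (<ᵇ-true (+-cancelˡ-< a j 2 b<h))))

shape-C₁₀ : ∀ q n x → shape (zeros q (ones n [])) x ≡ true ⇔ Rows (length (zeros q (ones n []))) n 0 x
shape-C₁₀ q n (a , b) = mk⇔
  (λ eq → shape⇒inR (zeros q (ones n [])) (a , b) eq , inj₁ (proj₂ (to (shape-1* n a b) (trans (sym (shape-zeros q _ (a , b))) eq))))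
  (λ { (x∈R , inj₁ b<n) → trans (shape-zeros q _ (a , b)) (from (shape-1* n a b) (proj₁ x∈R , b<n)) })

shape-C₁ : ∀ q x y z → shape (zeros q (ones x (false ∷ ones y []))) z ≡ true ⇔
  Rows (length (zeros q (ones x (false ∷ ones y [])))) (x + y) x z
shape-C₁ q x y (a , b) = mk⇔
  (λ eq → shape⇒inR (zeros q (ones x (false ∷ ones y []))) (a , b) eq ,
    (case to (shape-ones x _ a b) (trans (sym (shape-zeros q _ (a , b))) eq) of λ
      { (inj₁ (a<x , _ , b<n)) → case m≤n⇒m<n∨m≡n (≤-pred (subst (b <_) (trans (cong (λ m → x + suc m) |1*|) (+-suc x y)) b<n)) of λ
          { (inj₁ b<) → inj₁ b< ; (inj₂ b≡) → inj₂ (b≡ , a<x) }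
      ; (inj₂ (i , j , refl , refl , eq)) → inj₁ (+-monoʳ-< x (proj₂ (to (shape-1* y i j) eq))) }))
  (λ { (x∈R , c) → trans (shape-zeros q _ (a , b)) (inside (proj₁ x∈R) c) })
  where
  |1*| : length (ones y []) ≡ y
  |1*| = trans (length-rep true y []) (+-identityʳ y)
  inside : a ≤ b → b < x + y ⊎ (b ≡ x + y × a < x) → shape (ones x (false ∷ ones y [])) (a , b) ≡ true
  inside a≤b c with x ≤? a
  ... | no x≰a = from (shape-ones x _ a b) (inj₁ (≰⇒> x≰a , a≤b , subst (b <_) (sym (trans (cong (λ m → x + suc m) |1*|) (+-suc x y)))
                   (s≤s (case c of λ { (inj₁ b<) → <⇒≤ b< ; (inj₂ (b≡ , _)) → ≤-reflexive b≡ }))))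
  inside a≤b (inj₂ (_ , a<x)) | yes x≤a = ⊥-elim (<⇒≱ a<x x≤a)
  inside a≤b (inj₁ b<)        | yes x≤a with ≤⇒∃ x≤a | ≤⇒∃ (≤-trans x≤a a≤b)
  ... | i , refl | j , refl = shape-ones⇐ʳ x _ i j (from (shape-1* y i j) (+-cancelˡ-≤ x _ _ a≤b , +-cancelˡ-< x _ _ b<))

shape-C₂ : ∀ q d y a b → shape (zeros q (true ∷ zeros d (ones y []))) (a , b) ≡ true ⇔
  (inR (length (zeros q (true ∷ zeros d (ones y [])))) (a , b) × (b < suc y ⊎ (a ≡ 0 × b < suc y + d)))
shape-C₂ q d y a b = mk⇔
  (λ eq → shape⇒inR (zeros q (true ∷ zeros d (ones y []))) (a , b) eq , go⇒ a b (trans (sym (shape-zeros q _ (a , b))) eq))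
  (λ { (x∈R , c) → trans (shape-zeros q _ (a , b)) (go⇐ a b (proj₁ x∈R) c) })
  where
  len : length (zeros d (ones y [])) ≡ y + d
  len = trans (length-rep false d _) (trans (cong (d +_) (trans (length-rep true y []) (+-identityʳ y))) (+-comm d y))
  go⇒ : ∀ a b → shape (true ∷ zeros d (ones y [])) (a , b) ≡ true → b < suc y ⊎ (a ≡ 0 × b < suc y + d)
  go⇒ zero    b       eq = inj₂ (refl , subst (λ n → b < suc n) len (<ᵇ-true⁻¹ b _ eq))
  go⇒ (suc a) (suc b) eq = inj₁ (s≤s (proj₂ (to (shape-1* y a b) (trans (sym (shape-zeros d _ (a , b))) eq))))
  go⇐ : ∀ a b → a ≤ b → b < suc y ⊎ (a ≡ 0 × b < suc y + d) → shape (true ∷ zeros d (ones y [])) (a , b) ≡ true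
  go⇐ zero    b       a≤b       c            = <ᵇ-true (subst (λ n → b < suc n) (sym len)
    (case c of λ { (inj₁ b<) → ≤-trans b< (m≤m+n (suc y) d) ; (inj₂ (_ , b<)) → b< }))
  go⇐ (suc a) (suc b) (s≤s a≤b) (inj₁ (s≤s b<)) = trans (shape-zeros d _ (a , b)) (from (shape-1* y a b) (a≤b , b<))

shape-C₃ : ∀ q x a b → shape (zeros q (ones x (false ∷ false ∷ []))) (a , b) ≡ true ⇔
  (inR (length (zeros q (ones x (false ∷ false ∷ [])))) (a , b) × (a < x × b < x + 2))
shape-C₃ q x a b = mk⇔
  (λ eq → shape⇒inR (zeros q (ones x (false ∷ false ∷ []))) (a , b) eq ,
    (case to (shape-ones x _ a b) (trans (sym (shape-zeros q _ (a , b))) eq) of λ { (inj₁ (a<x , _ , b<)) → a<x , b< }))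
  (λ { (x∈R , a<x , b<) → trans (shape-zeros q _ (a , b)) (from (shape-ones x _ a b) (inj₁ (a<x , proj₁ x∈R , b<))) })

-- Symmetrization in a square

square : ℕ → ℕ → ℕ → Box
square s t e = box s (s + e) t (t + e)

square-coordinates : ∀ s t e {a b} → inQ (square s t e) (a , b) →
  Σ ℕ (λ i → Σ ℕ (λ j → s + i ≡ a × t + j ≡ b × i ≤ e × j ≤ e))
square-coordinates s t e (s≤a , a≤ , t≤b , b≤) with ≤⇒∃ s≤a | ≤⇒∃ t≤b
... | i , refl | j , refl = i , j , refl , refl , +-cancelˡ-≤ s _ _ a≤ , +-cancelˡ-≤ t _ _ b≤

square-inQ : ∀ s t e {i j} → i ≤ e → j ≤ e → inQ (square s t e) (s + i , t + j)
square-inQ s t e i≤e j≤e = m≤m+n s _ , +-monoʳ-≤ s i≤e , m≤m+n t _ , +-monoʳ-≤ t j≤e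

inQ? : ∀ Q x → Dec (inQ Q x)
inQ? Q (a , b) = s₁ Q ≤? a ×-dec a ≤? t₁ Q ×-dec s₂ Q ≤? b ×-dec b ≤? t₂ Q

-- The corner (s + e, t) is the one closest to the diagonal, and `s + e ≤ t` keeps it inside ℛ.
square-packed : ∀ ℓ s t e → s + e ≤ t → t + e < ℓ → IsPacked ℓ (square s t e)
square-packed ℓ s t e s+e≤t t+e<ℓ = m≤m+n s e , m≤m+n t e ,
  λ { (a , b) (_ , a≤ , t≤b , b≤) → ≤-trans a≤ (≤-trans s+e≤t t≤b) , ≤-<-trans b≤ t+e<ℓ }

square-defined : ∀ s t e c₁ c₂ → SymDefined (square s t e) c₁ c₂
square-defined s t e c₁ c₂ _ = trans (m+n∸m≡n s e) (sym (m+n∸m≡n t e))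

ρ-square : ∀ s t e i j → ρ (square s t e) (s + i , t + j) ≡ (s + j , t + i)
ρ-square s t e i j = cong₂ (λ i j → s + j , t + i) (m+n∸m≡n s i) (m+n∸m≡n t j)

fsym₁₂ : ∀ s t e i j → fsym (square s t e) zero (suc zero) (s + i , t + j) ≡ (if i <ᵇ j then (s + j , t + i) else (s + i , t + j))
fsym₁₂ s t e i j = cong₂ (λ c x → if c then x else (s + i , t + j)) (cong₂ _<ᵇ_ (m+n∸m≡n s i) (m+n∸m≡n t j)) (ρ-square s t e i j)

fsym₂₁ : ∀ s t e i j → fsym (square s t e) (suc zero) zero (s + i , t + j) ≡ (if j <ᵇ i then (s + j , t + i) else (s + i , t + j))
fsym₂₁ s t e i j = cong₂ (λ c x → if c then x else (s + i , t + j)) (cong₂ _<ᵇ_ (m+n∸m≡n t j) (m+n∸m≡n s i)) (ρ-square s t e i j)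

-- A lacks the top row of the square and I its last column.
sym₁₂ : ∀ s t e (A I : Pt → Bool) → (∀ x → ¬ inQ (square s t e) x → A x ≡ true ⇔ I x ≡ true) →
  (∀ i j → i ≤ e → j ≤ e → A (s + i , t + j) ≡ true ⇔ j < e) →
  (∀ i j → i ≤ e → j ≤ e → I (s + i , t + j) ≡ true ⇔ i < e) →
  ∀ x → A x ≡ true ⇔ SymMem (square s t e) I zero (suc zero) x
sym₁₂ s t e A I out inA inI x = mk⇔ (forward x) backward
  where
  Q = square s t e
  forward : ∀ x → A x ≡ true → SymMem Q I zero (suc zero) x
  forward x Ax with inQ? Q x
  ... | no  x∉Q = inj₁ (to (out x x∉Q) Ax , x∉Q)
  ... | yes x∈Q with square-coordinates s t e x∈Q
  ...   | i , j , refl , refl , i≤e , j≤e with to (inA i j i≤e j≤e) Ax | m≤n⇒m<n∨m≡n i≤e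
  ...     | j<e | inj₁ i<e = inj₂ (inj₁ (x∈Q , from (inI i j i≤e j≤e) i<e ,
    subst (λ y → I y ≡ true) (sym (ρ-square s t e i j)) (from (inI j i j≤e i≤e) j<e)))
  ...     | j<e | inj₂ refl = inj₂ (inj₂ ((s + j , t + i) , square-inQ s t e j≤e i≤e , from (inI j i j≤e i≤e) j<e ,
    sym (trans (fsym₁₂ s t e j i) (cong (λ c → if c then (s + i , t + j) else (s + j , t + i)) (<ᵇ-true j<e)))))
  backward : ∀ {x} → SymMem Q I zero (suc zero) x → A x ≡ true
  backward (inj₁ (Ix , x∉Q)) = from (out _ x∉Q) Ix
  backward (inj₂ (inj₁ (x∈Q , Ix , Iρx))) with square-coordinates s t e x∈Q
  ... | i , j , refl , refl , i≤e , j≤e = from (inA i j i≤e j≤e)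
    (to (inI j i j≤e i≤e) (subst (λ y → I y ≡ true) (ρ-square s t e i j) Iρx))
  backward (inj₂ (inj₂ (f , f∈Q , If , refl))) with square-coordinates s t e f∈Q
  ... | i , j , refl , refl , i≤e , j≤e rewrite fsym₁₂ s t e i j with i <ᵇ j in i<j
  ...   | true  = from (inA j i j≤e i≤e) (to (inI i j i≤e j≤e) If)
  ...   | false = from (inA i j i≤e j≤e) (≤-<-trans (≮⇒≥ (λ i<j′ → case trans (sym i<j) (<ᵇ-true i<j′) of λ ())) (to (inI i j i≤e j≤e) If))

-- A has only the first column of the square and I only its bottom row.
sym₂₁ : ∀ s t e (A I : Pt → Bool) → (∀ x → ¬ inQ (square s t e) x → A x ≡ true ⇔ I x ≡ true) →
  (∀ i j → i ≤ e → j ≤ e → A (s + i , t + j) ≡ true ⇔ i ≡ 0) →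
  (∀ i j → i ≤ e → j ≤ e → I (s + i , t + j) ≡ true ⇔ j ≡ 0) →
  ∀ x → A x ≡ true ⇔ SymMem (square s t e) I (suc zero) zero x
sym₂₁ s t e A I out inA inI x = mk⇔ (forward x) backward
  where
  Q = square s t e
  swap₀ : ∀ j → (s + 0 , t + j) ≡ (if 0 <ᵇ j then (s + 0 , t + j) else (s + j , t + 0))
  swap₀ zero    = refl
  swap₀ (suc j) = refl
  forward : ∀ x → A x ≡ true → SymMem Q I (suc zero) zero x
  forward x Ax with inQ? Q x
  ... | no  x∉Q = inj₁ (to (out x x∉Q) Ax , x∉Q)
  ... | yes x∈Q with square-coordinates s t e x∈Q
  ...   | i , j , refl , refl , i≤e , j≤e with to (inA i j i≤e j≤e) Ax
  ...     | refl = inj₂ (inj₂ ((s + j , t + 0) , square-inQ s t e j≤e i≤e , from (inI j 0 j≤e i≤e) refl ,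
    trans (swap₀ j) (sym (fsym₂₁ s t e j 0))))
  backward : ∀ {x} → SymMem Q I (suc zero) zero x → A x ≡ true
  backward (inj₁ (Ix , x∉Q)) = from (out _ x∉Q) Ix
  backward (inj₂ (inj₁ (x∈Q , Ix , Iρx))) with square-coordinates s t e x∈Q
  ... | i , j , refl , refl , i≤e , j≤e = from (inA i j i≤e j≤e)
    (to (inI j i j≤e i≤e) (subst (λ y → I y ≡ true) (ρ-square s t e i j) Iρx))
  backward (inj₂ (inj₂ (f , f∈Q , If , refl))) with square-coordinates s t e f∈Q
  ... | i , j , refl , refl , i≤e , j≤e with to (inI i j i≤e j≤e) If
  ...   | refl rewrite fsym₂₁ s t e i 0 = subst (λ y → A y ≡ true) (swap₀ i) (from (inA 0 i j≤e i≤e) refl)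

-- From the listed words to the classification

Classified : ℕ → ℕ → (Pt → Bool) → Set
Classified ℓ m A =
  (Σ Order (λ D → ∀ x → A x ≡ initSeg ℓ D m x))
  ⊎ Σ Order (λ D → Σ Box (λ Q → Σ (Fin 2) (λ c₁ → Σ (Fin 2) (λ c₂ →
      IsPacked ℓ Q × SymDefined Q c₁ c₂ ×
      (∀ x → (A x ≡ true) ⇔ SymMem Q (initSeg ℓ D m) c₁ c₂ x)))))

ClassifiedWord : Word → Set
ClassifiedWord ε = Classified (length ε) (size (length ε) (shape ε)) (shape ε)

SameSize : Word → Word → Set
SameSize ε δ = length δ ≡ length ε × W (λ _ → 1ℚ) 0 δ ≡ W (λ _ → 1ℚ) 0 ε

tied⇒sameSize : ∀ {ε δ} → Tied ε δ → SameSize ε δ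
tied⇒sameSize (tied len same) = sym len , sym (same _ 0)

-- Both sizes are the size of the triangle minus equal sizes. The letter `b` makes the length
-- positive, so that twice the length has a predecessor `N`.
tied⇒sameSize-complement : ∀ b {ε δ} → Tied (b ∷ ε) δ → SameSize (complement (b ∷ ε)) (complement δ)
tied⇒sameSize-complement b {ε} {δ} (tied len same) =
  trans (length-map not δ) (trans (sym len) (sym (length-map not (b ∷ ε)))) ,
  ⊞-cancelˡ (W 1* 0 δ) _ _ (begin
    W 1* 0 δ ⊞ W 1* 0 (complement δ)
      ≡⟨ W-complement 1* N 0 0 δ (cong (λ n → n + n) (sym len)) ⟩
    W 1* 0 (ones (length δ) [])
      ≡⟨ cong (λ n → W 1* 0 (ones n [])) (sym len) ⟩
    W 1* 0 (ones (length (b ∷ ε)) [])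
      ≡⟨ W-complement 1* N 0 0 (b ∷ ε) refl ⟨
    W 1* 0 (b ∷ ε) ⊞ W 1* 0 (complement (b ∷ ε))
      ≡⟨ cong (_⊞ W 1* 0 (complement (b ∷ ε))) (same 1* 0) ⟩
    W 1* 0 δ ⊞ W 1* 0 (complement (b ∷ ε)) ∎)
  where
  N = length ε + suc (length ε)
  1* : ℕ → ℚ
  1* _ = 1ℚ

sameSize⇒size : ∀ {ε δ} → SameSize ε δ → size (length δ) (shape δ) ≡ size (length ε) (shape ε)
sameSize⇒size {ε} {δ} (_ , eq) = fromℕ-injective (trans (fromℕ-size-shape 0 δ) (trans eq (sym (fromℕ-size-shape 0 ε))))

-- The initial segment of the size of `ε` is not computed by counting: it is the downset of a second
-- word `δ` of equal size, known to be an initial segment.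
initSeg-sameSize : ∀ {ε δ D} {P : ℕ → Pt → Set} → SameSize ε δ → (∀ x → shape δ x ≡ true ⇔ P (length δ) x) →
  (∀ x → shape δ x ≡ initSeg (length δ) D (size (length δ) (shape δ)) x) →
  ∀ x → initSeg (length ε) D (size (length ε) (shape ε)) x ≡ true ⇔ P (length ε) x
initSeg-sameSize {ε} {δ} {D} {P} same region seg x =
  subst (λ b → b ≡ true ⇔ P (length ε) x)
    (trans (seg x) (cong₂ (λ ℓ m → initSeg ℓ D m x) (proj₁ same) (sameSize⇒size {ε} {δ} same)))
    (subst (λ n → shape δ x ≡ true ⇔ P n x) (proj₁ same) (region x))

initSeg-columns : ∀ {ε δ p h} → SameSize ε δ → (∀ x → shape δ x ≡ true ⇔ Columns (length δ) p h x) →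
  ∀ x → initSeg (length ε) 𝓛 (size (length ε) (shape ε)) x ≡ true ⇔ Columns (length ε) p h x
initSeg-columns {ε} {δ} {p} {h} same region =
  initSeg-sameSize {ε} {δ} {D = 𝓛} {P = λ ℓ → Columns ℓ p h} same region (columns⇒initSeg (length δ) p h (shape δ) region)

initSeg-rows : ∀ {ε δ k r} → SameSize ε δ → (∀ x → shape δ x ≡ true ⇔ Rows (length δ) k r x) →
  ∀ x → initSeg (length ε) 𝓒 (size (length ε) (shape ε)) x ≡ true ⇔ Rows (length ε) k r x
initSeg-rows {ε} {δ} {k} {r} same region =
  initSeg-sameSize {ε} {δ} {D = 𝓒} {P = λ ℓ → Rows ℓ k r} same region (rows⇒initSeg (length δ) k r (shape δ) region)

-- The square spans columns `p` to `p + e` and the top `e + 1` rows. Inside it the downset lacks the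
-- top row; the initial segment, read off from the tied word, lacks the last column. Transposing the
-- square exchanges the two.
classify-L₂ : ∀ p e y → e ≤ suc y → ClassifiedWord (ones p (false ∷ ones (suc e) (zeros y [])))
classify-L₂ p e y e≤ = inj₂ (𝓛 , square p t e , zero , suc zero ,
  square-packed ℓ p t e (+-monoʳ-≤ p e≤) t+e<ℓ , square-defined p t e zero (suc zero) ,
  sym₁₂ p t e (shape ε) I out inA inI)
  where
  ε = ones p (false ∷ ones (suc e) (zeros y []))
  ℓ = length ε
  t = p + suc y
  I = initSeg ℓ 𝓛 (size ℓ (shape ε))
  eq₁ : ∀ p e y → p + suc (suc e + y) ≡ suc (p + suc y + e)
  eq₁ = solve-∀
  |ε| : ℓ ≡ suc (t + e)
  |ε| = trans (length-rep true p _) (trans (cong (λ n → p + suc n) (trans (length-rep true (suc e) _) (cong (suc e +_) (length-0* y)))) (eq₁ p e y))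
  t+e<ℓ : t + e < ℓ
  t+e<ℓ = ≤-reflexive (sym |ε|)
  regionI : ∀ x → I x ≡ true ⇔ Columns ℓ (p + e) t x
  regionI with m≤n⇒m<n∨m≡n e≤
  ... | inj₂ refl = initSeg-columns {ε} {ones (p + e) (zeros (suc e) [])}
    (subst (SameSize ε) (sym (rep-+ true p e _)) (tied⇒sameSize (tied-rep true p (tied-L₂-0 y))))
    (shape-L₁₀ (p + e) (suc e))
  ... | inj₁ (s≤s e≤y) with ≤⇒∃ e≤y
  ...   | j , refl = subst (λ h → ∀ x → I x ≡ true ⇔ Columns ℓ (p + e) h x) (trans (+-assoc p e (suc j)) (cong (p +_) (+-suc e j)))
    (initSeg-columns {ε} {ones (p + e) (zeros (suc e) (true ∷ zeros j []))}
      (subst (SameSize ε) (sym (rep-+ true p e _)) (tied⇒sameSize (tied-rep true p (tied-L₂ e j))))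
      (shape-L₁ (p + e) (suc e) j))
  inBox : ∀ i j → i ≤ e → j ≤ e → inR ℓ (p + i , t + j)
  inBox i j i≤e j≤e = proj₂ (proj₂ (square-packed ℓ p t e (+-monoʳ-≤ p e≤) t+e<ℓ)) _ (square-inQ p t e i≤e j≤e)
  inA : ∀ i j → i ≤ e → j ≤ e → shape ε (p + i , t + j) ≡ true ⇔ j < e
  inA i j i≤e j≤e = mk⇔
    (λ eq → case proj₂ (to (shape-L₂ p e y (p + i) (t + j)) eq) of λ
      { (inj₁ a<p)      → ⊥-elim (<⇒≱ a<p (m≤m+n p i))
      ; (inj₂ (_ , b<)) → +-cancelˡ-< t j e b< })
    (λ j<e → from (shape-L₂ p e y (p + i) (t + j)) (inBox i j i≤e j≤e , inj₂ (+-monoʳ-≤ p i≤e , +-monoʳ-< t j<e)))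
  inI : ∀ i j → i ≤ e → j ≤ e → I (p + i , t + j) ≡ true ⇔ i < e
  inI i j i≤e j≤e = mk⇔
    (λ eq → case proj₂ (to (regionI (p + i , t + j)) eq) of λ
      { (inj₁ a<)       → +-cancelˡ-< p i e a<
      ; (inj₂ (_ , b<)) → ⊥-elim (<⇒≱ b< (m≤m+n t j)) })
    (λ i<e → from (regionI (p + i , t + j)) (inBox i j i≤e j≤e , inj₁ (+-monoʳ-< p i<e)))
  out : ∀ x → ¬ inQ (square p t e) x → shape ε x ≡ true ⇔ I x ≡ true
  out (a , b) x∉Q = mk⇔
    (λ eq → let x∈R , c = to (shape-L₂ p e y a b) eq in from (regionI (a , b)) (x∈R , A⇒I x∈R c))
    (λ eq → let x∈R , c = to (regionI (a , b)) eq in from (shape-L₂ p e y a b) (x∈R , I⇒A x∈R c))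
    where
    below : inR ℓ (a , b) → p ≤ a → a ≤ p + e → b < t
    below (_ , b<ℓ) p≤a a≤ = ≰⇒> λ t≤b → x∉Q (p≤a , a≤ , t≤b , ≤-pred (subst (b <_) |ε| b<ℓ))
    A⇒I : inR ℓ (a , b) → a < p ⊎ (a ≤ p + e × b < t + e) → a < p + e ⊎ (a ≡ p + e × b < t)
    A⇒I x∈R (inj₁ a<p)      = inj₁ (≤-trans a<p (m≤m+n p e))
    A⇒I x∈R (inj₂ (a≤ , _)) with m≤n⇒m<n∨m≡n a≤
    ... | inj₁ a<  = inj₁ a<
    ... | inj₂ a≡  = inj₂ (a≡ , below x∈R (subst (p ≤_) (sym a≡) (m≤m+n p e)) a≤)
    I⇒A : inR ℓ (a , b) → a < p + e ⊎ (a ≡ p + e × b < t) → a < p ⊎ (a ≤ p + e × b < t + e)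
    I⇒A x∈R (inj₁ a<) with p ≤? a
    ... | no  p≰a = inj₁ (≰⇒> p≰a)
    ... | yes p≤a = inj₂ (<⇒≤ a< , ≤-trans (below x∈R p≤a (<⇒≤ a<)) (m≤m+n t e))
    I⇒A x∈R (inj₂ (refl , b<t)) = inj₂ (≤-refl , ≤-trans b<t (m≤m+n t e))

-- The square of side 2 with lower left corner (p, p + 1): the transposition takes the top cell (p,
-- p + 2) of the initial segment to (p + 1, p + 1), both of rank 2p + 2.
classify-L₃ : ∀ p x → ClassifiedWord (ones p (zeros (suc x) (true ∷ true ∷ [])))
classify-L₃ p x = inj₂ (𝓛 , square p (p + 1) 1 , zero , suc zero ,
  packed , square-defined p (p + 1) 1 zero (suc zero) ,
  sym₁₂ p (p + 1) 1 (shape ε) I out inA inI)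
  where
  ε = ones p (zeros (suc x) (true ∷ true ∷ []))
  ℓ = length ε
  I = initSeg ℓ 𝓛 (size ℓ (shape ε))
  eq₁ : ∀ p x → p + (suc x + 2) ≡ suc (p + 1 + 1) + x
  eq₁ = solve-∀
  packed : IsPacked ℓ (square p (p + 1) 1)
  packed = square-packed ℓ p (p + 1) 1 ≤-refl (≤-trans (m≤m+n _ x)
    (≤-reflexive (sym (trans (length-rep true p _) (trans (cong (p +_) (length-rep false (suc x) _)) (eq₁ p x))))))
  regionI : ∀ x → I x ≡ true ⇔ Columns ℓ p (p + 3) x
  regionI = initSeg-columns {ε} {ones p (zeros x (true ∷ zeros 2 []))}
    (tied⇒sameSize (tied-rep true p (tied-L₃ x))) (shape-L₁ p x 2)
  inBox : ∀ i j → i ≤ 1 → j ≤ 1 → inR ℓ (p + i , p + 1 + j)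
  inBox i j i≤ j≤ = proj₂ (proj₂ packed) _ (square-inQ p (p + 1) 1 i≤ j≤)
  inA : ∀ i j → i ≤ 1 → j ≤ 1 → shape ε (p + i , p + 1 + j) ≡ true ⇔ j < 1
  inA i j i≤ j≤ = mk⇔
    (λ eq → case proj₂ (to (shape-L₃ p (suc x) (p + i) (p + 1 + j)) eq) of λ
      { (inj₁ a<p)              → ⊥-elim (<⇒≱ a<p (m≤m+n p i))
      ; (inj₂ (inj₁ (_ , b<)))  → +-cancelˡ-< (p + 1) j 1 (subst (p + 1 + j <_) (sym (+-assoc p 1 1)) b<)
      ; (inj₂ (inj₂ (_ , b≡)))  → s≤s (≤-reflexive (+-cancelˡ-≡ (p + 1) j 0 (trans b≡ (sym (+-identityʳ (p + 1)))))) })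
    (λ j<1 → from (shape-L₃ p (suc x) (p + i) (p + 1 + j)) (inBox i j i≤ j≤ , inj₂ (corner i≤ j<1)))
    where
    corner : i ≤ 1 → j < 1 → (p + i ≡ p × p + 1 + j < p + 2) ⊎ (p + i ≡ p + 1 × p + 1 + j ≡ p + 1)
    corner z≤n       (s≤s z≤n) = inj₁ (+-identityʳ p , subst (_< p + 2) (sym (+-identityʳ (p + 1))) (+-monoʳ-< p ≤-refl))
    corner (s≤s z≤n) (s≤s z≤n) = inj₂ (refl , +-identityʳ (p + 1))
  inI : ∀ i j → i ≤ 1 → j ≤ 1 → I (p + i , p + 1 + j) ≡ true ⇔ i < 1
  inI i j i≤ j≤ = mk⇔
    (λ eq → case proj₂ (to (regionI (p + i , p + 1 + j)) eq) of λ
      { (inj₁ a<p)      → ⊥-elim (<⇒≱ a<p (m≤m+n p i))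
      ; (inj₂ (a≡ , _)) → s≤s (≤-reflexive (+-cancelˡ-≡ p i 0 (trans a≡ (sym (+-identityʳ p))))) })
    (λ { (s≤s z≤n) → from (regionI (p + i , p + 1 + j)) (inBox i j i≤ j≤ ,
      inj₂ (+-identityʳ p , subst (p + 1 + j <_) (+-assoc p 1 2) (+-monoʳ-< (p + 1) (s≤s j≤)))) })
  out : ∀ x → ¬ inQ (square p (p + 1) 1) x → shape ε x ≡ true ⇔ I x ≡ true
  out (a , b) x∉Q = mk⇔
    (λ eq → let x∈R , c = to (shape-L₃ p (suc x) a b) eq in from (regionI (a , b)) (x∈R , A⇒I c))
    (λ eq → let x∈R , c = to (regionI (a , b)) eq in from (shape-L₃ p (suc x) a b) (x∈R , I⇒A c))
    where
    A⇒I : a < p ⊎ (a ≡ p × b < p + 2) ⊎ (a ≡ p + 1 × b ≡ p + 1) → a < p ⊎ (a ≡ p × b < p + 3)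
    A⇒I (inj₁ a<p)                  = inj₁ a<p
    A⇒I (inj₂ (inj₁ (a≡p , b<)))    = inj₂ (a≡p , ≤-trans b< (+-monoʳ-≤ p (n≤1+n 2)))
    A⇒I (inj₂ (inj₂ (refl , refl))) = ⊥-elim (x∉Q (m≤m+n p 1 , ≤-refl , ≤-refl , m≤m+n (p + 1) 1))
    I⇒A : a < p ⊎ (a ≡ p × b < p + 3) → a < p ⊎ (a ≡ p × b < p + 2) ⊎ (a ≡ p + 1 × b ≡ p + 1)
    I⇒A (inj₁ a<p)         = inj₁ a<p
    I⇒A (inj₂ (refl , b<)) with b <? a + 2
    ... | yes b<′ = inj₂ (inj₁ (refl , b<′))
    ... | no  b≮  = ⊥-elim (x∉Q (≤-refl , m≤m+n a 1 , ≤-trans (+-monoʳ-≤ a (n≤1+n 1)) (≮⇒≥ b≮) ,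
      subst (b ≤_) (sym (+-assoc a 1 1)) (≤-pred (subst (b <_) (+-suc a 2) b<))))

complement-L₁ : ∀ p x y → complement (ones p (zeros x (true ∷ zeros y []))) ≡ zeros p (ones x (false ∷ ones y []))
complement-L₁ p x y = trans (complement-rep true p _) (cong (zeros p)
  (trans (complement-rep false x _) (cong (ones x ∘ (false ∷_)) (complement-rep false y []))))

complement-L₁₀ : ∀ p n → complement (ones p (zeros n [])) ≡ zeros p (ones n [])
complement-L₁₀ p n = trans (complement-rep true p _) (cong (zeros p) (complement-rep false n []))

complement-L₂ : ∀ p d y → complement (ones p (false ∷ ones d (zeros y []))) ≡ zeros p (true ∷ zeros d (ones y []))
complement-L₂ p d y = trans (complement-rep true p _) (cong (zeros p ∘ (true ∷_)) (complement-L₁₀ d y))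

complement-L₃ : ∀ p x → complement (ones p (zeros x (true ∷ true ∷ []))) ≡ zeros p (ones x (false ∷ false ∷ []))
complement-L₃ p x = trans (complement-rep true p _) (cong (zeros p) (complement-rep false x _))

∷-sameSize-complement : ∀ p b {ε δ} → Tied (b ∷ ε) δ → SameSize (complement (ones p (b ∷ ε))) (complement (ones p δ))
∷-sameSize-complement zero    b t = tied⇒sameSize-complement b t
∷-sameSize-complement (suc p) b t = tied⇒sameSize-complement true (tied-rep true (suc p) t)

-- Above the `k` full rows, the downset is a piece of column 0 and the initial segment a piece of
-- row `k`, both of `e + 1` cells; the square has these as its first column and bottom row.
classify-C₂ : ∀ q e y → e ≤ suc y → ClassifiedWord (zeros q (true ∷ zeros (suc e) (ones y [])))
classify-C₂ q e y e≤ = inj₂ (𝓒 , square 0 k e , suc zero , zero ,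
  packed , square-defined 0 k e (suc zero) zero , sym₂₁ 0 k e (shape ε) I out inA inI)
  where
  ε = zeros q (true ∷ zeros (suc e) (ones y []))
  ℓ = length ε
  k = suc y
  I = initSeg ℓ 𝓒 (size ℓ (shape ε))
  eq₁ : ∀ q e y → q + suc (suc e + y) ≡ suc (suc y + e) + q
  eq₁ = solve-∀
  packed : IsPacked ℓ (square 0 k e)
  packed = square-packed ℓ 0 k e e≤ (≤-trans (m≤m+n _ q) (≤-reflexive (sym (trans (length-rep false q _)
    (trans (cong (λ n → q + suc n) (trans (length-rep false (suc e) _) (cong (suc e +_) (trans (length-rep true y []) (+-identityʳ y)))))
      (eq₁ q e y))))))
  sameSize : ∀ {δ δ′} → Tied (false ∷ ones (suc e) (zeros y [])) δ → complement (ones q δ) ≡ δ′ → SameSize ε δ′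
  sameSize t eq = subst₂ SameSize (complement-L₂ q (suc e) y) eq (∷-sameSize-complement q false t)
  regionI : ∀ x → I x ≡ true ⇔ Rows ℓ k (suc e) x
  regionI with m≤n⇒m<n∨m≡n e≤
  -- Here k = e, and row `e` of ℛ has just `e + 1` cells: `e + 1` full rows are the same as `e` full
  -- rows and `e + 1` cells of the next.
  ... | inj₂ refl = λ { (a , b) → mk⇔
      (λ eq → let x∈R , c = to (region₀ (a , b)) eq in x∈R , ⇒ x∈R c)
      (λ { (x∈R , c) → from (region₀ (a , b)) (x∈R , inj₁ (⇐ c)) }) }
    where
    region₀ : ∀ x → I x ≡ true ⇔ Rows ℓ (suc e) 0 x
    region₀ = initSeg-rows {ε} {zeros (q + e) (ones (suc e) [])}
      (sameSize (tied-L₂-0 y) (trans (cong complement (sym (rep-+ true q e _))) (complement-L₁₀ (q + e) (suc e))))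
      (shape-C₁₀ (q + e) (suc e))
    ⇒ : ∀ {a b} → inR ℓ (a , b) → b < suc e ⊎ (b ≡ suc e × a < 0) → b < e ⊎ (b ≡ e × a < suc e)
    ⇒ (a≤b , _) (inj₁ (s≤s b≤e)) with m≤n⇒m<n∨m≡n b≤e
    ... | inj₁ b<e = inj₁ b<e
    ... | inj₂ b≡e = inj₂ (b≡e , s≤s (≤-trans a≤b b≤e))
    ⇐ : ∀ {a b} → b < e ⊎ (b ≡ e × a < suc e) → b < suc e
    ⇐ (inj₁ b<e)       = ≤-trans b<e (n≤1+n e)
    ⇐ (inj₂ (b≡e , _)) = s≤s (≤-reflexive b≡e)
  ... | inj₁ (s≤s e≤y) with ≤⇒∃ e≤y
  ...   | j , refl = initSeg-rows {ε} {zeros (q + e) (ones (suc e) (false ∷ ones j []))}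
      (sameSize (tied-L₂ e j) (trans (cong complement (sym (rep-+ true q e _))) (complement-L₁ (q + e) (suc e) j)))
      (shape-C₁ (q + e) (suc e) j)
  inBox : ∀ i j → i ≤ e → j ≤ e → inR ℓ (i , k + j)
  inBox i j i≤e j≤e = proj₂ (proj₂ packed) _ (square-inQ 0 k e i≤e j≤e)
  inA : ∀ i j → i ≤ e → j ≤ e → shape ε (i , k + j) ≡ true ⇔ i ≡ 0
  inA i j i≤e j≤e = mk⇔
    (λ eq → case proj₂ (to (shape-C₂ q (suc e) y i (k + j)) eq) of λ
      { (inj₁ b<)      → ⊥-elim (<⇒≱ b< (m≤m+n k j))
      ; (inj₂ (i≡0 , _)) → i≡0 })
    (λ i≡0 → from (shape-C₂ q (suc e) y i (k + j)) (inBox i j i≤e j≤e , inj₂ (i≡0 , +-monoʳ-< k (s≤s j≤e))))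
  inI : ∀ i j → i ≤ e → j ≤ e → I (i , k + j) ≡ true ⇔ j ≡ 0
  inI i j i≤e j≤e = mk⇔
    (λ eq → case proj₂ (to (regionI (i , k + j)) eq) of λ
      { (inj₁ b<)       → ⊥-elim (<⇒≱ b< (m≤m+n k j))
      ; (inj₂ (b≡ , _)) → +-cancelˡ-≡ k j 0 (trans b≡ (sym (+-identityʳ k))) })
    (λ { refl → from (regionI (i , k + 0)) (inBox i 0 i≤e z≤n , inj₂ (+-identityʳ k , s≤s i≤e)) })
  out : ∀ x → ¬ inQ (square 0 k e) x → shape ε x ≡ true ⇔ I x ≡ true
  out (a , b) x∉Q = mk⇔
    (λ eq → let x∈R , c = to (shape-C₂ q (suc e) y a b) eq in from (regionI (a , b)) (x∈R , A⇒I c))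
    (λ eq → let x∈R , c = to (regionI (a , b)) eq in from (shape-C₂ q (suc e) y a b) (x∈R , I⇒A c))
    where
    A⇒I : b < k ⊎ (a ≡ 0 × b < k + suc e) → b < k ⊎ (b ≡ k × a < suc e)
    A⇒I (inj₁ b<k)         = inj₁ b<k
    A⇒I (inj₂ (refl , b<)) = inj₁ (≰⇒> λ k≤b → x∉Q (z≤n , z≤n , k≤b , ≤-pred (subst (b <_) (+-suc k e) b<)))
    I⇒A : b < k ⊎ (b ≡ k × a < suc e) → b < k ⊎ (a ≡ 0 × b < k + suc e)
    I⇒A (inj₁ b<k)               = inj₁ b<k
    I⇒A (inj₂ (refl , s≤s a≤e)) = ⊥-elim (x∉Q (z≤n , a≤e , ≤-refl , m≤m+n k e))

-- The square has lower left corner (x, x + 1). The initial segment contains its bottom row, the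
-- downset its first column: the cells (x + 1, x + 1) and (x, x + 2), both of rank 2x + 2, change
-- places.
classify-C₃ : ∀ q x → ClassifiedWord (zeros q (ones (suc x) (false ∷ false ∷ [])))
classify-C₃ q x = inj₂ (𝓒 , square x (x + 1) 1 , suc zero , zero ,
  packed , square-defined x (x + 1) 1 (suc zero) zero , sym₂₁ x (x + 1) 1 (shape ε) I out inA inI)
  where
  ε = zeros q (ones (suc x) (false ∷ false ∷ []))
  ℓ = length ε
  I = initSeg ℓ 𝓒 (size ℓ (shape ε))
  eq₁ : ∀ q x → q + (suc x + 2) ≡ suc (x + 1 + 1) + q
  eq₁ = solve-∀
  packed : IsPacked ℓ (square x (x + 1) 1)
  packed = square-packed ℓ x (x + 1) 1 ≤-refl (≤-trans (m≤m+n _ q)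
    (≤-reflexive (sym (trans (length-rep false q _) (trans (cong (q +_) (length-rep true (suc x) _)) (eq₁ q x))))))
  regionI : ∀ z → I z ≡ true ⇔ Rows ℓ (x + 2) x z
  regionI = initSeg-rows {ε} {zeros q (ones x (false ∷ ones 2 []))}
    (subst₂ SameSize (complement-L₃ q (suc x)) (complement-L₁ q x 2) (∷-sameSize-complement q false (tied-L₃ x)))
    (shape-C₁ q x 2)
  inBox : ∀ i j → i ≤ 1 → j ≤ 1 → inR ℓ (x + i , x + 1 + j)
  inBox i j i≤ j≤ = proj₂ (proj₂ packed) _ (square-inQ x (x + 1) 1 i≤ j≤)
  inA : ∀ i j → i ≤ 1 → j ≤ 1 → shape ε (x + i , x + 1 + j) ≡ true ⇔ i ≡ 0
  inA i j i≤ j≤ = mk⇔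
    (λ eq → let _ , a< , _ = to (shape-C₃ q (suc x) (x + i) (x + 1 + j)) eq in
      n≤0⇒n≡0 (+-cancelˡ-≤ x i 0 (subst (x + i ≤_) (sym (+-identityʳ x)) (≤-pred a<))))
    (λ { refl → from (shape-C₃ q (suc x) (x + 0) (x + 1 + j)) (inBox 0 j z≤n j≤ ,
      s≤s (≤-reflexive (+-identityʳ x)) ,
      s≤s (subst (x + 1 + j ≤_) (+-assoc x 1 1) (+-monoʳ-≤ (x + 1) j≤))) })
  inI : ∀ i j → i ≤ 1 → j ≤ 1 → I (x + i , x + 1 + j) ≡ true ⇔ j ≡ 0
  inI i j i≤ j≤ = mk⇔
    (λ eq → case proj₂ (to (regionI (x + i , x + 1 + j)) eq) of λ
      { (inj₁ b<)       → n<1⇒n≡0 (+-cancelˡ-< (x + 1) j 1 (subst (x + 1 + j <_) (sym (+-assoc x 1 1)) b<))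
      ; (inj₂ (_ , a<)) → ⊥-elim (<⇒≱ a< (m≤m+n x i)) })
    (λ { refl → from (regionI (x + i , x + 1 + 0)) (inBox i 0 i≤ z≤n ,
      inj₁ (subst (_< x + 2) (sym (+-identityʳ (x + 1))) (+-monoʳ-< x ≤-refl))) })
  out : ∀ z → ¬ inQ (square x (x + 1) 1) z → shape ε z ≡ true ⇔ I z ≡ true
  out (a , b) z∉Q = mk⇔
    (λ eq → let z∈R , c = to (shape-C₃ q (suc x) a b) eq in from (regionI (a , b)) (z∈R , A⇒I c))
    (λ eq → let z∈R , c = to (regionI (a , b)) eq in from (shape-C₃ q (suc x) a b) (z∈R , I⇒A (proj₁ z∈R) c))
    where
    A⇒I : a < suc x × b < suc x + 2 → b < x + 2 ⊎ (b ≡ x + 2 × a < x)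
    A⇒I (s≤s a≤x , s≤s b≤) with m≤n⇒m<n∨m≡n b≤ | m≤n⇒m<n∨m≡n a≤x
    ... | inj₁ b<   | _         = inj₁ b<
    ... | inj₂ b≡   | inj₁ a<x  = inj₂ (b≡ , a<x)
    ... | inj₂ refl | inj₂ refl = ⊥-elim (z∉Q (≤-refl , m≤m+n a 1 , +-monoʳ-≤ a (n≤1+n 1) , ≤-reflexive (sym (+-assoc a 1 1))))
    I⇒A : a ≤ b → b < x + 2 ⊎ (b ≡ x + 2 × a < x) → a < suc x × b < suc x + 2
    I⇒A a≤b (inj₂ (refl , a<x)) = ≤-trans a<x (n≤1+n x) , ≤-refl
    I⇒A a≤b (inj₁ b<) with a ≤? x
    ... | yes a≤x = s≤s a≤x , ≤-trans b< (n≤1+n _)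
    ... | no  a≰x = ⊥-elim (z∉Q (<⇒≤ x<a , ≤-trans a≤b b≤x+1 , ≤-trans (subst (_≤ a) (+-comm 1 x) x<a) a≤b , ≤-trans b≤x+1 (m≤m+n (x + 1) 1)))
      where
      x<a : x < a
      x<a = ≰⇒> a≰x
      b≤x+1 : b ≤ x + 1
      b≤x+1 = ≤-pred (subst (b <_) (+-suc x 1) b<)

classify-L : ∀ {ε} → LForm ε → ClassifiedWord ε
classify-L (L₁₀ p n)           = inj₁ (𝓛 , columns⇒initSeg _ p p _ (shape-L₁₀ p n))
classify-L (L₁ p x y)          = inj₁ (𝓛 , columns⇒initSeg _ p (p + suc y) _ (shape-L₁ p x y))
classify-L (L₂ p zero y d≤)    = classify-L (L₁₀ p (suc y))
classify-L (L₂ p (suc e) y d≤) = classify-L₂ p e y (≤-pred d≤)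
-- With no zeros in front, the triangle of side 2 completes the full columns to all of ℛ.
classify-L (L₃ p zero)         = subst ClassifiedWord (rep-+ true p 2 []) (classify-L (L₁₀ (p + 2) 0))
classify-L (L₃ p (suc x))      = classify-L₃ p x

classify-C : ∀ {ε} → LForm ε → ClassifiedWord (complement ε)
classify-C (L₁₀ p n)           = subst ClassifiedWord (sym (complement-L₁₀ p n))
  (inj₁ (𝓒 , rows⇒initSeg _ n 0 _ (shape-C₁₀ p n)))
classify-C (L₁ p x y)          = subst ClassifiedWord (sym (complement-L₁ p x y))
  (inj₁ (𝓒 , rows⇒initSeg _ (x + y) x _ (shape-C₁ p x y)))
classify-C (L₂ p zero y d≤)    = classify-C (L₁₀ p (suc y))
classify-C (L₂ p (suc e) y d≤) = subst ClassifiedWord (sym (complement-L₂ p (suc e) y)) (classify-C₂ p e y (≤-pred d≤))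
classify-C (L₃ p zero)         = subst (ClassifiedWord ∘ complement) (rep-+ true p 2 []) (classify-C (L₁₀ (p + 2) 0))
classify-C (L₃ p (suc x))      = subst ClassifiedWord (sym (complement-L₃ p (suc x))) (classify-C₃ p x)

classified-cong : ∀ ℓ m {A B} → (∀ x → A x ≡ B x) → Classified ℓ m B → Classified ℓ m A
classified-cong ℓ m eq (inj₁ (D , seg)) = inj₁ (D , λ x → trans (eq x) (seg x))
classified-cong ℓ m eq (inj₂ (D , Q , c₁ , c₂ , packed , defined , mem)) =
  inj₂ (D , Q , c₁ , c₂ , packed , defined , λ x → mk⇔ (λ Ax → to (mem x) (trans (sym (eq x)) Ax)) (λ m → trans (eq x) (from (mem x) m)))

theorem5p5 : (ℓ : ℕ) → 1 ≤ ℓ → (wt : Pt → ℚ) → RankConstant ℓ wt → RankIncreasing ℓ wt →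
    (A : Pt → Bool) → IsOptimal ℓ wt A →
    (Σ Order (λ D → ∀ x → A x ≡ initSeg ℓ D (size ℓ A) x))
    ⊎ Σ Order (λ D → Σ Box (λ Q → Σ (Fin 2) (λ c₁ → Σ (Fin 2) (λ c₂ →
    IsPacked ℓ Q × SymDefined Q c₁ c₂ ×
    (∀ x → (A x ≡ true) ⇔ SymMem Q (initSeg ℓ D (size ℓ A)) c₁ c₂ x)))))
theorem5p5 (suc ℓ) 1≤ℓ wt const inc A opt with downset⇒form ℓ wt const inc A opt
... | ε , len , eq , form = classified-cong (suc ℓ) (size (suc ℓ) A) eq
  (subst₂ (λ n m → Classified n m (shape ε)) len
    (trans (cong (λ n → size n (shape ε)) len) (sym (size-cong (suc ℓ) eq)))
    (classify form))
  where
  classify : LForm ε ⊎ CForm ε → ClassifiedWord ε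
  classify (inj₁ l) = classify-L l
  classify (inj₂ c) = subst ClassifiedWord (complement-involutive ε) (classify-C c)
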